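{- For a nonempty $\Pi^0_1$ set $P\subseteq2^{\mathbb N}$ the following are equivalent: $P$ is $(1,<\omega)$-complete; $P$ is $(1,\omega|<\omega)$-complete; $P$ is $(<\omega,1)$-complete.
   Context: Let $\{\Phi_e\}_{e\in\mathbb N}$ be an effective enumeration of all partial computable functions $\Phi_e:\subseteq\mathbb N^{\mathbb N}\to\mathbb N^{\mathbb N}$. A learner is a total computable function $\Psi:\mathbb N^{<\mathbb N}\to\mathbb N$. A partial function $\Gamma:\subseteq\mathbb N^{\mathbb N}\to\mathbb N^{\mathbb N}$ is identified by $\Psi$ if for every $g\in\mathrm{dom}(\Gamma)$ the limit $\lim_n\Psi(g\upharpoonright n)$ exists and $\Phi_{\lim_n\Psi(g\upharpoonright n)}(g)=\Gamma(g)$. $\Gamma$ is $(1,<\omega)$-computable if it is identified by a learner $\Psi$ with $\sup_{g\in\mathrm{dom}(\Gamma)}\#\{n:\Psi(g\upharpoonright (n+1))\neq\Psi(g\upharpoonright n)\}<\omega$. $\Gamma$ is $(1,\omega|<\omega)$-computable if it is identified by a learner $\Psi$ with $\sup_{g\in\mathrm{dom}(\Gamma)}\#\{\Psi(g\upharpoonright n):n\in\mathbb N\}<\omega$. $\Gamma$ is $(<\omega,1)$-computable if there is $b\in\mathbb N$ such that for every $g\in\mathrm{dom}(\Gamma)$, $\Gamma(g)=\Phi_e(g)$ for some $e<b$. For each of these three notions (written $(\alpha,\beta|\gamma)$) and $A,B\subseteq\mathbb N^{\mathbb N}$, $A\le^\alpha_{\beta|\gamma}B$ means there is a partial function $\Gamma$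 computable in that sense with $B\subseteq\mathrm{dom}(\Gamma)$ and $\Gamma(g)\in A$ for every $g\in B$. A nonempty $\Pi^0_1$ set $P\subseteq2^{\mathbb N}$ is $(\alpha,\beta|\gamma)$-complete if $Q\le^\alpha_{\beta|\gamma}P$ for every nonempty $\Pi^0_1$ set $Q\subseteq 2^{\mathbb N}$. -}

module Defs where

open import Data.Fin.Base using (Fin)
open import Data.List.Base using (List; []; _∷_; length; applyUpTo)
open import Data.List.Relation.Unary.All using (All)
open import Data.List.Relation.Unary.Unique.Propositional using (Unique)
open import Data.Nat.Base using (ℕ; zero; suc; _*_; _^_; _≤_; _<_)
open import Data.Product.Base using (∃; ∃-syntax; _×_)
open import Data.Vec.Base as Vec using (Vec; []; _∷_)
open import Data.Vec.Relation.Binary.Pointwise.Inductive using (Pointwise)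
open import Function.Bundles using (_⇔_)
open import Level using (0ℓ)
open import Relation.Binary.Core using (Rel)
open import Relation.Binary.Definitions using (_Respects₂_)
open import Relation.Binary.PropositionalEquality using (_≡_; _≢_; _≗_)
open import Relation.Unary using (Pred; _∈_; _⊆_; Satisfiable)

-- Points of Baire space are identified up to pointwise equality _≗_.
Baire : Set
Baire = ℕ → ℕ

Cantor : Pred Baire 0ℓ
Cantor x = ∀ n → x n < 2

_↾_ : Baire → ℕ → List ℕ
g ↾ n = applyUpTo g n

------------------------------------------------------------------------
-- Partial recursive functions relative to an oracle

data Program : ℕ → Set where
  zero   : Program 0
  suc    : Program 1
  proj   : ∀ {n} → Fin n → Program n
  oracle : Program 1
  comp   : ∀ {m n} → Program m → Vec (Program n) m → Program n
  rec    : ∀ {n} → Program n → Program (suc (suc n)) → Program (suc n)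
  mu     : ∀ {n} → Program (suc n) → Program n

infix 4 _⊢_[_]⇓_

data _⊢_[_]⇓_ (g : Baire) : ∀ {n} → Program n → Vec ℕ n → ℕ → Set where
  zero   : g ⊢ zero [ [] ]⇓ 0
  suc    : ∀ {x} → g ⊢ suc [ x ∷ [] ]⇓ suc x
  proj   : ∀ {n} {i : Fin n} {xs} → g ⊢ proj i [ xs ]⇓ Vec.lookup xs i
  oracle : ∀ {x} → g ⊢ oracle [ x ∷ [] ]⇓ g x
  comp   : ∀ {m n} {p : Program m} {qs : Vec (Program n) m} {xs ys z} →
           Pointwise (λ q y → g ⊢ q [ xs ]⇓ y) qs ys →
           g ⊢ p [ ys ]⇓ z →
           g ⊢ comp p qs [ xs ]⇓ z
  rec0   : ∀ {n} {p : Program n} {q xs y} →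
           g ⊢ p [ xs ]⇓ y →
           g ⊢ rec p q [ 0 ∷ xs ]⇓ y
  recS   : ∀ {n} {p : Program n} {q k xs y z} →
           g ⊢ rec p q [ k ∷ xs ]⇓ y →
           g ⊢ q [ k ∷ y ∷ xs ]⇓ z →
           g ⊢ rec p q [ suc k ∷ xs ]⇓ z
  mu     : ∀ {n} {p : Program (suc n)} {xs k} →
           (∀ j → j < k → ∃[ y ] g ⊢ p [ j ∷ xs ]⇓ suc y) →
           g ⊢ p [ k ∷ xs ]⇓ 0 →
           g ⊢ mu p [ xs ]⇓ k

-- A bijective Gödel numbering of finite strings.
code : List ℕ → ℕ
code []      = 0
code (x ∷ σ) = 2 ^ x * suc (2 * code σ)

-- Ordinary (oracle-free) computability: the oracle has no influence.
Computable : (List ℕ → ℕ) → Set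
Computable Ψ =
  ∃[ p ] (∀ g σ → g ⊢ p [ code σ ∷ [] ]⇓ Ψ σ)

------------------------------------------------------------------------
-- Partial functions on Baire space

record PartialFunction : Set₁ where
  field
    Graph      : Rel Baire 0ℓ
    resp       : Graph Respects₂ _≗_
    functional : ∀ {g h h′} → Graph g h → Graph g h′ → h ≗ h′

  dom : Pred Baire 0ℓ
  dom g = ∃[ h ] Graph g h

open PartialFunction public using (Graph; dom)

_≃_ : PartialFunction → PartialFunction → Set
Γ ≃ Δ = ∀ g h → Graph Γ g h ⇔ Graph Δ g h

-- The domain consists of the oracles relative to which the program halts
-- on every input.
PartialComputable : PartialFunction → Set
PartialComputable Γ =
  ∃[ p ] (∀ g h → Graph Γ g h ⇔ (∀ n → g ⊢ p [ n ∷ [] ]⇓ h n))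

record EffectiveEnumeration (Φ : ℕ → PartialFunction) : Set₁ where
  field
    -- (e , g) ↦ Φ e g is partial computable; in particular so is each Φ e.
    effective : ∃[ u ] (∀ e g h →
                  Graph (Φ e) g h ⇔ (∀ n → g ⊢ u [ e ∷ n ∷ [] ]⇓ h n))
    all       : ∀ Γ → PartialComputable Γ → ∃[ e ] Φ e ≃ Γ

------------------------------------------------------------------------
-- Learnability

-- # S ≤ k
AtMost : ℕ → Pred ℕ 0ℓ → Set
AtMost k S = ∀ ns → Unique ns → All S ns → length ns ≤ k

_⟶_ : (ℕ → ℕ) → ℕ → Set
s ⟶ e = ∃[ N ] (∀ n → N ≤ n → s n ≡ e)

record Learner : Set where
  field
    guess      : List ℕ → ℕ
    computable : Computable guess

open Learner public using (guess)

mindChanges : Learner → Baire → Pred ℕ 0ℓ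
mindChanges Ψ g n = guess Ψ (g ↾ suc n) ≢ guess Ψ (g ↾ n)

guesses : Learner → Baire → Pred ℕ 0ℓ
guesses Ψ g e = ∃[ n ] guess Ψ (g ↾ n) ≡ e

module _ (Φ : ℕ → PartialFunction) where

  _Identifies_ : Learner → PartialFunction → Set
  Ψ Identifies Γ = ∀ g h → Graph Γ g h →
    ∃[ e ] ((λ n → guess Ψ (g ↾ n)) ⟶ e) × Graph (Φ e) g h

  -- (1,<ω)
  BoundedMindChanges : PartialFunction → Set
  BoundedMindChanges Γ = ∃[ Ψ ] Ψ Identifies Γ ×
    ∃[ k ] (∀ g → g ∈ dom Γ → AtMost k (mindChanges Ψ g))

  -- (1,ω|<ω)
  BoundedGuesses : PartialFunction → Set
  BoundedGuesses Γ = ∃[ Ψ ] Ψ Identifies Γ ×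
    ∃[ k ] (∀ g → g ∈ dom Γ → AtMost k (guesses Ψ g))

  -- (<ω,1)
  BoundedlyNonuniform : PartialFunction → Set
  BoundedlyNonuniform Γ =
    ∃[ b ] (∀ g h → Graph Γ g h → ∃[ e ] e < b × Graph (Φ e) g h)

------------------------------------------------------------------------
-- Reducibility and completeness

_≤⟨_⟩_ : Pred Baire 0ℓ → (PartialFunction → Set) → Pred Baire 0ℓ → Set₁
A ≤⟨ C ⟩ B = ∃[ Γ ] C Γ × B ⊆ dom Γ × (∀ g h → g ∈ B → Graph Γ g h → h ∈ A)

Π⁰₁ : Pred Baire 0ℓ → Set
Π⁰₁ P = ∃[ R ] Computable R × (∀ g → g ∈ P ⇔ (∀ n → R (g ↾ n) ≡ 0))

record NonemptyΠ⁰₁Class (P : Pred Baire 0ℓ) : Set where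
  field
    binary   : P ⊆ Cantor
    isΠ⁰₁    : Π⁰₁ P
    nonempty : Satisfiable P

Complete : (PartialFunction → Set) → Pred Baire 0ℓ → Set₁
Complete C P = ∀ Q → NonemptyΠ⁰₁Class Q → Q ≤⟨ C ⟩ P

{-# OPTIONS --safe #-}

-- Only the passage from (<ω,1)- to (1,<ω)-completeness needs an idea; the
-- other two implications hold for each Γ separately. Given a Π⁰₁ class Q, let
-- x ∈ D if at every node v of the binary tree x v is a direction that does not
-- die out at a level where its sibling is still alive. D is a nonempty Π⁰₁
-- class, following the directions of x ∈ D leads to an element of Q, and D is
-- homogeneous: membership is a condition on each value x v separately. Suppose
-- that for every g ∈ P one of Φ 0 g, …, Φ (b - 1) g lies in D. A value
-- violating D is recognised in finite time, so a learner can count the e < b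
-- that have been refuted, which takes at most b mind changes. Once the count is
-- final, the remaining functions only produce correct values, though they may
-- be partial; at each v take the first value that any of them produces. By
-- homogeneity these values together form an element of D.
module Submission where

open import Axiom.ExcludedMiddle using (ExcludedMiddle)
open import Data.Fin.Base as Fin using (Fin; zero; suc)
open import Data.Fin.Patterns
open import Data.List.Base as List using (List; []; _∷_; length; upTo; filter)
open import Data.List.Membership.Propositional as Membership using ()
open import Data.List.Membership.Propositional.Properties using (∈-filter⁺; ∈-upTo⁺; ∈-map⁺)
open import Data.List.Properties using (filter-notAll; length-upTo; length-map)
open import Data.List.Relation.Unary.All as All using (All; []; _∷_)
open import Data.List.Relation.Unary.All.Properties using (all-filter)
open import Data.List.Relation.Unary.AllPairs using ([]; _∷_)
open import Data.List.Relation.Unary.Any as Any using (here; there)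
open import Data.List.Relation.Unary.Unique.Propositional using (Unique)
open import Data.List.Relation.Unary.Unique.Propositional.Properties using (filter⁺; upTo⁺)
open import Data.Nat.Base hiding (parity)
open import Data.Nat.Properties
open import Data.Product.Base using (∃-syntax; _×_; _,_; proj₁; proj₂)
open import Data.Sum.Base using (_⊎_; inj₁; inj₂)
open import Data.Vec.Base as Vec using (Vec; []; _∷_; head; tail; lookup)
open import Data.Vec.Properties using (∷-injective)
open import Data.Vec.Relation.Binary.Pointwise.Inductive using (Pointwise; []; _∷_)
open import Function.Base using (_∘_; id; case_of_)
open import Function.Bundles using (_⇔_; mk⇔; module Equivalence)
open import Level using (0ℓ)
open import Relation.Binary.Definitions using (tri<; tri≈; tri>)
open import Relation.Binary.PropositionalEquality
open import Relation.Nullary using (yes; no; contradiction)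
open import Relation.Nullary.Decidable using (¬?)
open import Relation.Unary using (Pred; Satisfiable)
open import Defs

-- Survival of a node to a given level is a finite question, so a direction that dies before its
-- sibling is eventually caught, and the condition on `x v` involves only `v` and `x v`. It also
-- constrains `x` at nodes through which no element of Q passes; some direction is admissible there
-- too, because two siblings cannot each die strictly before the other. The guess of the learner
-- depends on the number j of refuted functions and not on which ones they are. The refuted set only
-- grows, so it is final as soon as its size has reached the limit value, and a program that knows
-- this value can wait for that moment by itself. Hence b + 1 programs suffice. Their indices come
-- from `all`, which says nothing about computing them, but finitely many numbers can be built into
-- a learner. In the step from boundedly many guesses to boundedly many functions, the obstacle is
-- that the guesses vary with g and may be arbitrarily large. They are replaced by the programs that
-- run the i-th new guess, for i below the bound. Excluded middle supplies the element of D and the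
-- limit of the count.

private
  variable
    m n : ℕ

-- Oracle computations are deterministic and extensional in the oracle

mutual
  deterministic : ∀ {g} {p : Program n} {xs y z} →
                  g ⊢ p [ xs ]⇓ y → g ⊢ p [ xs ]⇓ z → y ≡ z
  deterministic zero zero = refl
  deterministic suc suc = refl
  deterministic proj proj = refl
  deterministic oracle oracle = refl
  deterministic (comp ds d) (comp es e)
    rewrite deterministics ds es = deterministic d e
  deterministic (rec0 d) (rec0 e) = deterministic d e
  deterministic (recS d d′) (recS e e′)
    rewrite deterministic d e = deterministic d′ e′
  deterministic (mu {k = k} ds d) (mu {k = l} es e) with <-cmp k l
  ... | tri≈ _ k≡l _ = k≡l
  ... | tri< k<l _ _ = contradiction (deterministic d (proj₂ (es k k<l))) 0≢1+n
  ... | tri> _ _ l<k = contradiction (deterministic (proj₂ (ds l l<k)) e) 1+n≢0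

  deterministics : ∀ {g} {qs : Vec (Program n) m} {xs ys zs} →
                   Pointwise (λ q y → g ⊢ q [ xs ]⇓ y) qs ys →
                   Pointwise (λ q z → g ⊢ q [ xs ]⇓ z) qs zs → ys ≡ zs
  deterministics [] [] = refl
  deterministics (d ∷ ds) (e ∷ es) =
    cong₂ _∷_ (deterministic d e) (deterministics ds es)

mutual
  extensional : ∀ {g h} → g ≗ h → ∀ {p : Program n} {xs y} →
                g ⊢ p [ xs ]⇓ y → h ⊢ p [ xs ]⇓ y
  extensional g≗h zero = zero
  extensional g≗h suc = suc
  extensional g≗h proj = proj
  extensional {h = h} g≗h (oracle {x}) =
    subst (h ⊢ oracle [ x ∷ [] ]⇓_) (sym (g≗h x)) oracle
  extensional g≗h (comp ds d) = comp (extensionals g≗h ds) (extensional g≗h d)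
  extensional g≗h (rec0 d) = rec0 (extensional g≗h d)
  extensional g≗h (recS d e) = recS (extensional g≗h d) (extensional g≗h e)
  extensional g≗h (mu ds d) =
    mu (λ j j<k → proj₁ (ds j j<k) , extensional g≗h (proj₂ (ds j j<k)))
       (extensional g≗h d)

  extensionals : ∀ {g h} → g ≗ h → ∀ {qs : Vec (Program n) m} {xs ys} →
                 Pointwise (λ q y → g ⊢ q [ xs ]⇓ y) qs ys →
                 Pointwise (λ q y → h ⊢ q [ xs ]⇓ y) qs ys
  extensionals g≗h [] = []
  extensionals g≗h (d ∷ ds) = extensional g≗h d ∷ extensionals g≗h ds

⟪_⟫ : Program 1 → PartialFunction
⟪ p ⟫ = record
  { Graph      = λ g h → ∀ n → g ⊢ p [ n ∷ [] ]⇓ h n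
  ; resp       = (λ {g} h≗k d n → subst (g ⊢ p [ n ∷ [] ]⇓_) (h≗k n) (d n))
               , (λ g≗k d n → extensional g≗k (d n))
  ; functional = λ d e n → deterministic (d n) (e n)
  }

-- Total functions computed by programs

record Recursive (f : Baire → Vec ℕ n → ℕ) : Set where
  field
    program  : Program n
    computes : ∀ g xs → g ⊢ program [ xs ]⇓ f g xs

record Recursives (fs : Baire → Vec ℕ n → Vec ℕ m) : Set where
  field
    programs : Vec (Program n) m
    compute  : ∀ g xs → Pointwise (λ q y → g ⊢ q [ xs ]⇓ y) programs (fs g xs)

open Recursive public
open Recursives public

recursive-≗ : {f f′ : Baire → Vec ℕ n → ℕ} →
              (∀ g xs → f g xs ≡ f′ g xs) → Recursive f → Recursive f′
recursive-≗ f≡f′ r .program = r .program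
recursive-≗ f≡f′ r .computes g xs =
  subst (g ⊢ r .program [ xs ]⇓_) (f≡f′ g xs) (r .computes g xs)

infixr 5 _◂_
infix 8 _⟦_⟧

ε : Recursives {n} (λ _ _ → [])
ε .programs = []
ε .compute _ _ = []

_◂_ : {f : Baire → Vec ℕ n → ℕ} {fs : Baire → Vec ℕ n → Vec ℕ m} →
      Recursive f → Recursives fs → Recursives (λ g xs → f g xs ∷ fs g xs)
(r ◂ rs) .programs = r .program ∷ rs .programs
(r ◂ rs) .compute g xs = r .computes g xs ∷ rs .compute g xs

_⟦_⟧ : {f : Baire → Vec ℕ m → ℕ} {fs : Baire → Vec ℕ n → Vec ℕ m} →
       Recursive f → Recursives fs → Recursive (λ g xs → f g (fs g xs))
(r ⟦ rs ⟧) .program = comp (r .program) (rs .programs)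
(r ⟦ rs ⟧) .computes g xs = comp (rs .compute g xs) (r .computes g _)

var : (i : Fin n) → Recursive (λ _ xs → lookup xs i)
var i .program = proj i
var i .computes _ _ = proj

projections : (ρ : Fin m → Fin n) (f : Vec ℕ n → Vec ℕ m) →
              (∀ xs i → lookup xs (ρ i) ≡ lookup (f xs) i) →
              Recursives (λ _ → f)
projections ρ f eq .programs = Vec.tabulate (proj ∘ ρ)
projections ρ f eq .compute g xs = go ρ (f xs) (eq xs)
  where
  go : ∀ {k} (σ : Fin k → Fin _) ys → (∀ i → lookup xs (σ i) ≡ lookup ys i) →
       Pointwise (λ q y → g ⊢ q [ xs ]⇓ y) (Vec.tabulate (proj ∘ σ)) ys
  go σ []       _  = []
  go σ (y ∷ ys) eq =
    subst (g ⊢ proj (σ zero) [ xs ]⇓_) (eq zero) proj ∷ go (σ ∘ suc) ys (eq ∘ suc)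

vars : Recursives {n} (λ _ xs → xs)
vars = projections id id (λ _ _ → refl)

-- Weakening for de Bruijn variables: `r ⟦ vars₁ ⟧` moves `r` under one bound variable, and `vars₂`
-- does so under the two that `natrecʳ` introduces.
vars₁ : Recursives {suc n} (λ _ xs → tail xs)
vars₁ = projections Fin.suc tail λ { (_ ∷ _) _ → refl }

vars₂ : Recursives {2+ n} (λ _ xs → tail (tail xs))
vars₂ = projections (λ i → Fin.suc (Fin.suc i)) (tail ∘ tail) λ { (_ ∷ _ ∷ _) _ → refl }

sucʳ : {f : Baire → Vec ℕ n → ℕ} → Recursive f → Recursive (λ g xs → suc (f g xs))
sucʳ r .program = comp suc (r .program ∷ [])
sucʳ r .computes g xs = comp (r .computes g xs ∷ []) suc

const : ∀ k → Recursive {n} (λ _ _ → k)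
const zero .program = comp zero []
const zero .computes _ _ = comp [] zero
const (suc k) = sucʳ (const k)

oracleʳ : {f : Baire → Vec ℕ n → ℕ} → Recursive f → Recursive (λ g xs → g (f g xs))
oracleʳ r .program = comp oracle (r .program ∷ [])
oracleʳ r .computes g xs = comp (r .computes g xs ∷ []) oracle

-- `∑`, `search`, `parity`, `half`, `halves` and `codeTails` are written as instances of `natrec`,
-- so that `natrecʳ` yields their programs directly; the standard arithmetic operations are linked
-- to it by `recursive-≗`.
natrec : ℕ → (ℕ → ℕ → ℕ) → ℕ → ℕ
natrec a f zero    = a
natrec a f (suc k) = f k (natrec a f k)

natrecʳ : {k a : Baire → Vec ℕ n → ℕ} {f : Baire → Vec ℕ (2+ n) → ℕ} →
          Recursive k → Recursive a → Recursive f →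
          Recursive (λ g xs → natrec (a g xs) (λ i y → f g (i ∷ y ∷ xs)) (k g xs))
natrecʳ {n} {a = a} {f} k r s = primrec ⟦ k ◂ vars ⟧
  where
  primrec : Recursive (λ g xs → natrec (a g (tail xs)) (λ i y → f g (i ∷ y ∷ tail xs)) (head xs))
  primrec .program = rec (r .program) (s .program)
  primrec .computes g (zero ∷ xs)  = rec0 (r .computes g xs)
  primrec .computes g (suc k ∷ xs) =
    recS (primrec .computes g (k ∷ xs)) (s .computes g _)

ifz : ℕ → ℕ → ℕ → ℕ
ifz k a b = natrec a (λ _ _ → b) k

isZero sgn : ℕ → ℕ
isZero k = ifz k 1 0
sgn k = ifz k 0 1

infixl 6 _+ʳ_ _∸ʳ_
infixl 7 _*ʳ_

_+ʳ_ : {f f′ : Baire → Vec ℕ n → ℕ} → Recursive f → Recursive f′ →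
       Recursive (λ g xs → f g xs + f′ g xs)
_+ʳ_ {f = f} {f′} r r′ =
  recursive-≗ (λ g xs → +-natrec (f g xs) (f′ g xs)) (natrecʳ r r′ (sucʳ (var 1F)))
  where
  +-natrec : ∀ a b → natrec b (λ _ y → suc y) a ≡ a + b
  +-natrec zero    b = refl
  +-natrec (suc a) b = cong suc (+-natrec a b)

predʳ : {f : Baire → Vec ℕ n → ℕ} → Recursive f → Recursive (λ g xs → pred (f g xs))
predʳ {f = f} r = recursive-≗ (λ g xs → pred-natrec (f g xs)) (natrecʳ r (const 0) (var 0F))
  where
  pred-natrec : ∀ a → natrec 0 (λ i _ → i) a ≡ pred a
  pred-natrec zero    = refl
  pred-natrec (suc a) = refl

_*ʳ_ : {f f′ : Baire → Vec ℕ n → ℕ} → Recursive f → Recursive f′ →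
       Recursive (λ g xs → f g xs * f′ g xs)
_*ʳ_ {f = f} {f′} r r′ =
  recursive-≗ (λ g xs → *-natrec (f g xs) (f′ g xs))
    (natrecʳ r (const 0) (r′ ⟦ vars₂ ⟧ +ʳ var 1F))
  where
  *-natrec : ∀ a b → natrec 0 (λ _ y → b + y) a ≡ a * b
  *-natrec zero    b = refl
  *-natrec (suc a) b = cong (b +_) (*-natrec a b)

_∸ʳ_ : {f f′ : Baire → Vec ℕ n → ℕ} → Recursive f → Recursive f′ →
       Recursive (λ g xs → f g xs ∸ f′ g xs)
_∸ʳ_ {f = f} {f′} r r′ =
  recursive-≗ (λ g xs → ∸-natrec (f g xs) (f′ g xs)) (natrecʳ r′ r (predʳ (var 1F)))
  where
  ∸-natrec : ∀ a b → natrec a (λ _ y → pred y) b ≡ a ∸ b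
  ∸-natrec a zero    = refl
  ∸-natrec a (suc b) = trans (cong pred (∸-natrec a b)) (pred[m∸n]≡m∸[1+n] a b)

2^ʳ : {f : Baire → Vec ℕ n → ℕ} → Recursive f → Recursive (λ g xs → 2 ^ f g xs)
2^ʳ {f = f} r = recursive-≗ (λ g xs → ^-natrec (f g xs))
                  (natrecʳ r (const 1) (const 2 *ʳ var 1F))
  where
  ^-natrec : ∀ a → natrec 1 (λ _ y → 2 * y) a ≡ 2 ^ a
  ^-natrec zero    = refl
  ^-natrec (suc a) = cong (2 *_) (^-natrec a)

ifzʳ : {f a b : Baire → Vec ℕ n → ℕ} → Recursive f → Recursive a → Recursive b →
       Recursive (λ g xs → ifz (f g xs) (a g xs) (b g xs))
ifzʳ r s t = natrecʳ r s (t ⟦ vars₂ ⟧)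

isZeroʳ : {f : Baire → Vec ℕ n → ℕ} → Recursive f → Recursive (λ g xs → isZero (f g xs))
isZeroʳ r = ifzʳ r (const 1) (const 0)

sgnʳ : {f : Baire → Vec ℕ n → ℕ} → Recursive f → Recursive (λ g xs → sgn (f g xs))
sgnʳ r = ifzʳ r (const 0) (const 1)

∑ : ℕ → (ℕ → ℕ) → ℕ
∑ k f = natrec 0 (λ i s → f i + s) k

∑ʳ : {k : Baire → Vec ℕ n → ℕ} {f : Baire → Vec ℕ (suc n) → ℕ} →
     Recursive k → Recursive f →
     Recursive (λ g xs → ∑ (k g xs) (λ i → f g (i ∷ xs)))
∑ʳ r s = natrecʳ r (const 0) (s ⟦ var 0F ◂ vars₂ ⟧ +ʳ var 1F)

-- The least i < k with f i ≢ 0, and k if there is none: the candidate is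
-- advanced as long as f vanishes at it.
search : ℕ → (ℕ → ℕ) → ℕ
search k f = natrec 0 (λ _ c → c + isZero (f c)) k

searchʳ : {k : Baire → Vec ℕ n → ℕ} {f : Baire → Vec ℕ (suc n) → ℕ} →
          Recursive k → Recursive f →
          Recursive (λ g xs → search (k g xs) (λ i → f g (i ∷ xs)))
searchʳ r s = natrecʳ r (const 0) (var 1F +ʳ isZeroʳ (s ⟦ var 1F ◂ vars₂ ⟧))

-- Arithmetic of truth values, bounded sums and bounded search

isZero≢0 : ∀ {a} → isZero a ≢ 0 → a ≡ 0
isZero≢0 {zero}  _ = refl
isZero≢0 {suc a} p = contradiction refl p

isZero≡0 : ∀ {a} → isZero a ≡ 0 → a ≢ 0
isZero≡0 {suc a} _ ()

≢0⇒isZero≡0 : ∀ {a} → a ≢ 0 → isZero a ≡ 0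
≢0⇒isZero≡0 {zero}  p = contradiction refl p
≢0⇒isZero≡0 {suc a} _ = refl

≢0⇒suc : ∀ {a} → a ≢ 0 → ∃[ b ] a ≡ suc b
≢0⇒suc {zero}  p = contradiction refl p
≢0⇒suc {suc a} _ = a , refl

sgn≤1 : ∀ a → sgn a ≤ 1
sgn≤1 zero    = z≤n
sgn≤1 (suc a) = ≤-refl

sgn-mono : ∀ {a b} → (a ≢ 0 → b ≢ 0) → sgn a ≤ sgn b
sgn-mono {zero}          _ = z≤n
sgn-mono {suc a} {zero}  p = contradiction refl (p λ ())
sgn-mono {suc a} {suc b} _ = ≤-refl

sgn≡sgn : ∀ {a b} → sgn a ≡ sgn b → a ≡ 0 → b ≡ 0
sgn≡sgn {b = zero} _ _ = refl
sgn≡sgn {b = suc b} () refl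

sgn*≡suc : ∀ {a b c} → sgn a * b ≡ suc c → ∃[ d ] a ≡ suc d × b ≡ suc c
sgn*≡suc {suc a} {b} eq = a , refl , trans (sym (*-identityˡ b)) eq

*≢0 : ∀ {a b} → a * b ≢ 0 → a ≢ 0 × b ≢ 0
*≢0 {a} p = (λ { refl → p refl }) , (λ { refl → p (*-zeroʳ a) })

≢0* : ∀ {a b} → a ≢ 0 → b ≢ 0 → a * b ≢ 0
≢0* {a} p q eq with m*n≡0⇒m≡0∨n≡0 a eq
... | inj₁ a≡0 = p a≡0
... | inj₂ b≡0 = q b≡0

∑≡0⇒ : ∀ k {f i} → ∑ k f ≡ 0 → i < k → f i ≡ 0
∑≡0⇒ (suc k) {f} {i} eq i<1+k with m≤n⇒m<n∨m≡n (s≤s⁻¹ i<1+k)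
... | inj₁ i<k  = ∑≡0⇒ k (m+n≡0⇒n≡0 (f k) eq) i<k
... | inj₂ refl = m+n≡0⇒m≡0 (f k) eq

⇒∑≡0 : ∀ k {f} → (∀ i → i < k → f i ≡ 0) → ∑ k f ≡ 0
⇒∑≡0 zero    _ = refl
⇒∑≡0 (suc k) p = cong₂ _+_ (p k ≤-refl) (⇒∑≡0 k (λ i i<k → p i (m<n⇒m<1+n i<k)))

∑≢0⇒ : ∀ k {f} → ∑ k f ≢ 0 → ∃[ i ] i < k × f i ≢ 0
∑≢0⇒ zero p = contradiction refl p
∑≢0⇒ (suc k) {f} p with f k ≟ 0
... | no  fk≢0 = k , ≤-refl , fk≢0
... | yes fk≡0 = let i , i<k , fi≢0 = ∑≢0⇒ k (λ eq → p (cong₂ _+_ fk≡0 eq))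
                 in i , m<n⇒m<1+n i<k , fi≢0

⇒∑≢0 : ∀ k {f i} → i < k → f i ≢ 0 → ∑ k f ≢ 0
⇒∑≢0 k i<k fi≢0 eq = fi≢0 (∑≡0⇒ k eq i<k)

∑-mono : ∀ k {f f′} → (∀ i → f i ≤ f′ i) → ∑ k f ≤ ∑ k f′
∑-mono zero    p = z≤n
∑-mono (suc k) p = +-mono-≤ (p k) (∑-mono k p)

∑-monoˡ : ∀ {k l} f → k ≤ l → ∑ k f ≤ ∑ l f
∑-monoˡ {k} {zero}  f z≤n = z≤n
∑-monoˡ {k} {suc l} f k≤1+l with m≤n⇒m<n∨m≡n k≤1+l
... | inj₁ k<1+l = ≤-trans (∑-monoˡ f (s≤s⁻¹ k<1+l)) (m≤n+m _ (f l))
... | inj₂ refl  = ≤-refl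

∑≤ : ∀ k {f} → (∀ i → f i ≤ 1) → ∑ k f ≤ k
∑≤ zero    p = z≤n
∑≤ (suc k) p = +-mono-≤ (p k) (∑≤ k p)

∑-≡ : ∀ k {f f′} → (∀ i → f i ≤ f′ i) → ∑ k f ≡ ∑ k f′ → ∀ {i} → i < k → f i ≡ f′ i
∑-≡ (suc k) {f} {f′} p eq {i} i<1+k with m≤n⇒m<n∨m≡n (p k)
... | inj₁ fk<f′k = contradiction eq (<⇒≢ (+-mono-<-≤ fk<f′k (∑-mono k p)))
... | inj₂ fk≡f′k with m≤n⇒m<n∨m≡n (s≤s⁻¹ i<1+k)
...   | inj₂ refl = fk≡f′k
...   | inj₁ i<k  =
  ∑-≡ k p (+-cancelˡ-≡ (f k) _ _ (trans eq (cong (_+ ∑ k f′) (sym fk≡f′k)))) i<k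

search≤ : ∀ k f → search k f ≤ k
search≤ zero    f = z≤n
search≤ (suc k) f with f (search k f)
... | zero  = ≤-trans (≤-reflexive (+-comm (search k f) 1)) (s≤s (search≤ k f))
... | suc _ = ≤-trans (≤-reflexive (+-identityʳ (search k f))) (m≤n⇒m≤1+n (search≤ k f))

<search : ∀ k f {j} → j < search k f → f j ≡ 0
<search (suc k) f {j} j< with f (search k f) in eq
... | suc _ = <search k f (subst (j <_) (+-identityʳ _) j<)
... | zero  with m≤n⇒m<n∨m≡n (s≤s⁻¹ (subst (j <_) (+-comm (search k f) 1) j<))
...   | inj₁ j<s  = <search k f j<s
...   | inj₂ refl = eq

-- The case `a ≡ k` is included: then nothing is found below `k`, and the default value `k` is
-- already the right answer.
search≡ : ∀ k f {a} → f a ≢ 0 → (∀ j → j < a → f j ≡ 0) → a ≤ k → search k f ≡ a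
search≡ zero    f fa≢0 below z≤n = refl
search≡ (suc k) f {a} fa≢0 below a≤1+k with m≤n⇒m<n∨m≡n a≤1+k
... | inj₁ a<1+k rewrite search≡ k f fa≢0 below (s≤s⁻¹ a<1+k) | ≢0⇒isZero≡0 fa≢0 = +-identityʳ a
... | inj₂ refl = trans (cong (λ c → c + isZero (f c)) (start k ≤-refl))
                    (trans (cong (k +_) (cong isZero (below k ≤-refl))) (+-comm k 1))
  where
  start : ∀ l → l < suc k → search l f ≡ l
  start zero    _ = refl
  start (suc l) l< = trans (cong (λ c → c + isZero (f c)) (start l (<-trans ≤-refl l<)))
    (trans (cong (l +_) (cong isZero (below l (<-trans ≤-refl l<)))) (+-comm l 1))

least : ∀ (f : ℕ → ℕ) {N} → f N ≡ 0 →
        ∃[ k ] k ≤ N × f k ≡ 0 × (∀ j → j < k → f j ≢ 0)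
least f {N} fN≡0 = from 0 N (λ _ ()) refl
  where
  from : ∀ a d → (∀ j → j < a → f j ≢ 0) → a + d ≡ N →
         ∃[ k ] k ≤ N × f k ≡ 0 × (∀ j → j < k → f j ≢ 0)
  from a zero below refl rewrite +-identityʳ a = a , ≤-refl , fN≡0 , below
  from a (suc d) below refl with f a ≟ 0
  ... | yes fa≡0 = a , m≤m+n a _ , fa≡0 , below
  ... | no  fa≢0 = from (suc a) d below′ (sym (+-suc a d))
    where
    below′ : ∀ j → j < suc a → f j ≢ 0
    below′ j j<1+a with m≤n⇒m<n∨m≡n (s≤s⁻¹ j<1+a)
    ... | inj₁ j<a  = below j j<a
    ... | inj₂ refl = fa≢0

-- Codes of strings

parity half : ℕ → ℕ
parity k = natrec 0 (λ _ b → 1 ∸ b) k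
half k = natrec 0 (λ i h → parity i + h) k

parity<2 : ∀ k → parity k < 2
parity<2 zero    = s≤s z≤n
parity<2 (suc k) = s≤s (m∸n≤m 1 (parity k))

parity-suc-suc : ∀ k → parity (suc (suc k)) ≡ parity k
parity-suc-suc k = m∸[m∸n]≡n (s≤s⁻¹ (parity<2 k))

half-suc-suc : ∀ k → half (suc (suc k)) ≡ suc (half k)
half-suc-suc k = begin
  (1 ∸ parity k) + (parity k + half k) ≡⟨ +-assoc (1 ∸ parity k) _ _ ⟨
  (1 ∸ parity k + parity k) + half k   ≡⟨ cong (_+ half k) (m∸n+n≡m (s≤s⁻¹ (parity<2 k))) ⟩
  suc (half k)                         ∎
  where open ≡-Reasoning

private
  2*suc : ∀ b v → b + 2 * suc v ≡ suc (suc (b + 2 * v))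
  2*suc b v = begin
    b + 2 * suc v           ≡⟨ cong (b +_) (*-suc 2 v) ⟩
    b + suc (suc (2 * v))   ≡⟨ +-suc b _ ⟩
    suc (b + suc (2 * v))   ≡⟨ cong suc (+-suc b _) ⟩
    suc (suc (b + 2 * v))   ∎
    where open ≡-Reasoning

parity-bit : ∀ b v → b < 2 → parity (b + 2 * v) ≡ b
parity-bit 0 zero    _ = refl
parity-bit 1 zero    _ = refl
parity-bit b@0 (suc v) p = trans (cong parity (2*suc b v))
  (trans (parity-suc-suc (b + 2 * v)) (parity-bit b v p))
parity-bit b@1 (suc v) p = trans (cong parity (2*suc b v))
  (trans (parity-suc-suc (b + 2 * v)) (parity-bit b v p))
parity-bit (2+ _) _ (s≤s (s≤s ()))

half-bit : ∀ b v → b < 2 → half (b + 2 * v) ≡ v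
half-bit 0 zero    _ = refl
half-bit 1 zero    _ = refl
half-bit b@0 (suc v) p = trans (cong half (2*suc b v))
  (trans (half-suc-suc (b + 2 * v)) (cong suc (half-bit b v p)))
half-bit b@1 (suc v) p = trans (cong half (2*suc b v))
  (trans (half-suc-suc (b + 2 * v)) (cong suc (half-bit b v p)))
half-bit (2+ _) _ (s≤s (s≤s ()))

half≤ : ∀ k → half k ≤ k
half≤ zero    = z≤n
half≤ (suc k) = +-mono-≤ (s≤s⁻¹ (parity<2 k)) (half≤ k)

halves : ℕ → ℕ → ℕ
halves i c = natrec c (λ _ a → half a) i

halves-suc : ∀ i c → halves (suc i) c ≡ halves i (half c)
halves-suc zero    c = refl
halves-suc (suc i) c = cong half (halves-suc i c)

parityʳ : {f : Baire → Vec ℕ n → ℕ} → Recursive f → Recursive (λ g xs → parity (f g xs))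
parityʳ r = natrecʳ r (const 0) (const 1 ∸ʳ var 1F)

halfʳ : {f : Baire → Vec ℕ n → ℕ} → Recursive f → Recursive (λ g xs → half (f g xs))
halfʳ r = natrecʳ r (const 0) (parityʳ (var 0F) +ʳ var 1F)

halvesʳ : {i f : Baire → Vec ℕ n → ℕ} → Recursive i → Recursive f →
          Recursive (λ g xs → halves (i g xs) (f g xs))
halvesʳ r s = natrecʳ r s (halfʳ (var 1F))

cons : ℕ → ℕ → ℕ
cons x c = 2 ^ x * suc (2 * c)

-- In binary, `cons x c` is the expansion of `c` followed by a digit 1 and `x` zeros. The head is
-- thus the number of halvings before the first odd value, and one more halving removes the
-- separating 1. The code itself bounds the search because `x < 2 ^ x`.
codeHead codeTail : ℕ → ℕ
codeHead c = search c (λ i → parity (halves i c))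
codeTail c = halves (suc (codeHead c)) c

consʳ : {f f′ : Baire → Vec ℕ n → ℕ} → Recursive f → Recursive f′ →
        Recursive (λ g xs → cons (f g xs) (f′ g xs))
consʳ r s = 2^ʳ r *ʳ sucʳ (const 2 *ʳ s)

codeHeadʳ : {f : Baire → Vec ℕ n → ℕ} → Recursive f → Recursive (λ g xs → codeHead (f g xs))
codeHeadʳ r = searchʳ r (parityʳ (halvesʳ (var 0F) (r ⟦ vars₁ ⟧)))

codeTailʳ : {f : Baire → Vec ℕ n → ℕ} → Recursive f → Recursive (λ g xs → codeTail (f g xs))
codeTailʳ r = halvesʳ (sucʳ (codeHeadʳ r)) r

n<2^n : ∀ n → n < 2 ^ n
n<2^n zero    = s≤s z≤n
n<2^n (suc n) = ≤-trans (s≤s (n<2^n n))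
  (subst (suc (2 ^ n) ≤_) (cong (2 ^ n +_) (sym (+-identityʳ (2 ^ n))))
    (+-monoˡ-≤ (2 ^ n) (m^n>0 2 n)))

private
  half-2^ : ∀ x d → half (2 ^ suc x * d) ≡ 2 ^ x * d
  half-2^ x d = trans (cong half (*-assoc 2 (2 ^ x) d)) (half-bit 0 (2 ^ x * d) (s≤s z≤n))

  halves-2^ : ∀ x d → halves x (2 ^ x * d) ≡ d
  halves-2^ zero    d = +-identityʳ d
  halves-2^ (suc x) d = trans (halves-suc x _)
    (trans (cong (halves x) (half-2^ x d)) (halves-2^ x d))

  parity-halves-2^ : ∀ x d j → j < x → parity (halves j (2 ^ x * d)) ≡ 0
  parity-halves-2^ (suc x) d zero    _ =
    trans (cong parity (*-assoc 2 (2 ^ x) d)) (parity-bit 0 (2 ^ x * d) (s≤s z≤n))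
  parity-halves-2^ (suc x) d (suc j) j<x =
    trans (cong parity (trans (halves-suc j _) (cong (halves j) (half-2^ x d))))
      (parity-halves-2^ x d j (s≤s⁻¹ j<x))

<cons : ∀ x c → x < cons x c
<cons x c = ≤-trans (n<2^n x) (m≤m*n (2 ^ x) (suc (2 * c)))

codeHead-cons : ∀ x c → codeHead (cons x c) ≡ x
codeHead-cons x c = search≡ (cons x c) _ odd (parity-halves-2^ x _) (<⇒≤ (<cons x c))
  where
  odd : parity (halves x (cons x c)) ≢ 0
  odd eq = 1+n≢0 (trans (sym (parity-bit 1 c ≤-refl))
                   (trans (cong parity (sym (halves-2^ x _))) eq))

codeTail-cons : ∀ x c → codeTail (cons x c) ≡ c
codeTail-cons x c rewrite codeHead-cons x c =
  trans (cong half (halves-2^ x _)) (half-bit 1 c ≤-refl)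

cons≢0 : ∀ x c → cons x c ≢ 0
cons≢0 x c = m<n⇒n≢0 (<cons x c)

code<cons : ∀ x c → c < cons x c
code<cons x c = ≤-trans (s≤s (m≤m+n c (1 * c)))
  (m≤n*m (suc (2 * c)) (2 ^ x) {{>-nonZero (m^n>0 2 x)}})

-- Entries and initial segments

codeTails : ℕ → ℕ → ℕ
codeTails i c = natrec c (λ _ d → codeTail d) i

codeTails-suc : ∀ i c → codeTails (suc i) c ≡ codeTails i (codeTail c)
codeTails-suc zero    c = refl
codeTails-suc (suc i) c = cong codeTail (codeTails-suc i c)

opaque
  -- The i-th entry of the string coded by c, increased by one, or 0 if the
  -- string is too short.
  entry : ℕ → ℕ → ℕ
  entry c i = ifz (codeTails i c) 0 (suc (codeHead (codeTails i c)))

  entryʳ : {c i : Baire → Vec ℕ n → ℕ} → Recursive c → Recursive i →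
           Recursive (λ g xs → entry (c g xs) (i g xs))
  entryʳ r s = let tails = natrecʳ s r (codeTailʳ (var 1F)) in
    ifzʳ tails (const 0) (sucʳ (codeHeadʳ tails))

  entry-nil : ∀ i → entry 0 i ≡ 0
  entry-nil i = cong (λ d → ifz d 0 (suc (codeHead d))) (tails≡0 i)
    where
    tails≡0 : ∀ i → codeTails i 0 ≡ 0
    tails≡0 zero    = refl
    tails≡0 (suc i) = cong codeTail (tails≡0 i)

  entry-zero : ∀ x c → entry (cons x c) 0 ≡ suc x
  entry-zero x c with cons x c in eq
  ... | zero  = contradiction eq (cons≢0 x c)
  ... | suc d = cong suc (trans (cong codeHead (sym eq)) (codeHead-cons x c))

  entry-suc : ∀ x c i → entry (cons x c) (suc i) ≡ entry c i
  entry-suc x c i = cong (λ d → ifz d 0 (suc (codeHead d)))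
    (trans (codeTails-suc i (cons x c)) (cong (codeTails i) (codeTail-cons x c)))

  entry-< : ∀ g {i n} → i < n → entry (code (g ↾ n)) i ≡ suc (g i)
  entry-< g {zero}  {suc n} _   = entry-zero (g 0) (code ((g ∘ suc) ↾ n))
  entry-< g {suc i} {suc n} i<n = trans (entry-suc (g 0) (code ((g ∘ suc) ↾ n)) i) (entry-< (g ∘ suc) (s≤s⁻¹ i<n))

  entry≡suc : ∀ g n {i y} → entry (code (g ↾ n)) i ≡ suc y → i < n × g i ≡ y
  entry≡suc g zero {i} eq = contradiction (trans (sym (entry-nil i)) eq) 0≢1+n
  entry≡suc g (suc n) {zero} eq =
    s≤s z≤n , suc-injective (trans (sym (entry-zero (g 0) (code ((g ∘ suc) ↾ n)))) eq)
  entry≡suc g (suc n) {suc i} eq =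
    let i<n , gi≡y = entry≡suc (g ∘ suc) n (trans (sym (entry-suc (g 0) (code ((g ∘ suc) ↾ n)) i)) eq)
    in s≤s i<n , gi≡y

code-mono : ∀ g {m n} → m ≤ n → code (g ↾ m) ≤ code (g ↾ n)
code-mono g {zero}  _   = z≤n
code-mono g {suc m} {suc n} m≤n =
  *-monoʳ-≤ (2 ^ g 0) (s≤s (*-monoʳ-≤ 2 (code-mono (g ∘ suc) (s≤s⁻¹ m≤n))))

n≤code : ∀ g n → n ≤ code (g ↾ n)
n≤code g zero    = z≤n
n≤code g (suc n) = ≤-<-trans (n≤code (g ∘ suc) n) (code<cons (g 0) (code ((g ∘ suc) ↾ n)))

↾-cong : ∀ {g h} n → (∀ i → i < n → g i ≡ h i) → g ↾ n ≡ h ↾ n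
↾-cong zero    _ = refl
↾-cong (suc n) p = cong₂ _∷_ (p 0 (s≤s z≤n)) (↾-cong n (λ i i<n → p (suc i) (s≤s i<n)))

-- The code of the last `k` entries of `g ↾ n`. Strings grow at the front, whereas the recursion
-- counts upwards, so the prefix is assembled from its end.
segment : Baire → ℕ → ℕ → ℕ
segment g n k = natrec 0 (λ i c → cons (g (n ∸ suc i)) c) k

segment≡ : ∀ g n k m → m + k ≡ n → segment g n k ≡ code ((λ j → g (m + j)) ↾ k)
segment≡ g n zero    m eq = refl
segment≡ g n (suc k) m eq = cong₂ cons
  (cong g (trans (cong (_∸ suc k) (sym eq)) (trans (m+n∸n≡m m (suc k)) (sym (+-identityʳ m)))))
  (trans (segment≡ g n k (suc m) (trans (sym (+-suc m k)) eq))
    (cong code (↾-cong k (λ j _ → cong g (sym (+-suc m j))))))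

restrictionʳ : {k : Baire → Vec ℕ n → ℕ} → Recursive k →
               Recursive (λ g xs → code (g ↾ k g xs))
restrictionʳ {k = k} r = recursive-≗ (λ g xs → segment≡ g (k g xs) (k g xs) 0 refl)
  (natrecʳ r (const 0) (consʳ (oracleʳ (r ⟦ vars₂ ⟧ ∸ʳ sucʳ (var 0F))) (var 1F)))

computableʳ : ∀ {Ψ} → Computable Ψ → {σ : Baire → Vec ℕ n → List ℕ} →
              Recursive (λ g xs → code (σ g xs)) → Recursive (λ g xs → Ψ (σ g xs))
computableʳ (p , _) r .program = comp p (r .program ∷ [])
computableʳ (_ , d) {σ} r .computes g xs = comp (r .computes g xs ∷ []) (d g (σ g xs))

-- Approximating a computation from a finite part of its oracle

defined : Vec ℕ n → ℕ
defined []       = 1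
defined (y ∷ ys) = sgn y * defined ys

mutual
  -- approx p c xs is suc y if p with oracle the string coded by c outputs y
  -- on xs, where c also bounds the unbounded searches, and 0 otherwise.
  approx : Program n → ℕ → Vec ℕ n → ℕ
  approx zero        c xs       = 1
  approx suc         c (x ∷ []) = suc (suc x)
  approx (proj i)    c xs       = suc (lookup xs i)
  approx oracle      c (x ∷ []) = entry c x
  approx (comp p qs) c xs       =
    sgn (defined (approxs qs c xs)) * approx p c (Vec.map pred (approxs qs c xs))
  approx (rec p q)   c (k ∷ xs) =
    natrec (approx p c xs) (λ i y → sgn y * approx q c (i ∷ pred y ∷ xs)) k
  approx (mu p)      c xs       =
    -- The search stops at the first `j` whose value is 0 (undefined) or 1 (output 0). The product
    -- then equals `suc k` in the second case; it is 0 in the first case and also when the search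
    -- ends at a larger value.
    let value = λ j → approx p c (j ∷ xs)
        k     = search c (λ j → isZero (pred (value j)))
    in isZero (pred (value k)) * (value k * suc k)

  approxs : Vec (Program n) m → ℕ → Vec ℕ n → Vec ℕ m
  approxs []       c xs = []
  approxs (q ∷ qs) c xs = approx q c xs ∷ approxs qs c xs

definedʳ : {fs : Baire → Vec ℕ n → Vec ℕ m} → Recursives fs →
           Recursive (λ g xs → defined (fs g xs))
definedʳ rs = go ⟦ rs ⟧
  where
  go : ∀ {m} → Recursive (λ (_ : Baire) (ys : Vec ℕ m) → defined ys)
  go {zero}  = recursive-≗ (λ { _ [] → refl }) (const 1)
  go {suc m} = recursive-≗ (λ { _ (_ ∷ _) → refl }) (sgnʳ (var 0F) *ʳ (go ⟦ vars₁ ⟧))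

infix 8 _⟦_⟧ˢ

_⟦_⟧ˢ : ∀ {k} {fs : Baire → Vec ℕ m → Vec ℕ k} {gs : Baire → Vec ℕ n → Vec ℕ m} →
        Recursives fs → Recursives gs → Recursives (λ g xs → fs g (gs g xs))
(rs ⟦ ss ⟧ˢ) .programs = Vec.map (λ q → comp q (ss .programs)) (rs .programs)
_⟦_⟧ˢ {gs = gs} rs ss .compute g xs = go (rs .compute g (gs g xs))
  where
  go : ∀ {k} {qs : Vec (Program _) k} {ys : Vec ℕ k} →
       Pointwise (λ q y → g ⊢ q [ gs g xs ]⇓ y) qs ys →
       Pointwise (λ q y → g ⊢ q [ xs ]⇓ y) (Vec.map (λ q → comp q (ss .programs)) qs) ys
  go []       = []
  go (d ∷ ds) = comp (ss .compute g xs) d ∷ go ds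

predsʳ : {fs : Baire → Vec ℕ n → Vec ℕ m} → Recursives fs →
         Recursives (λ g xs → Vec.map pred (fs g xs))
predsʳ rs .programs = Vec.map (λ q → comp (predʳ (var 0F) .program) (q ∷ [])) (rs .programs)
predsʳ rs .compute g xs = go (rs .compute g xs)
  where
  go : ∀ {k} {qs : Vec (Program _) k} {ys : Vec ℕ k} →
       Pointwise (λ q y → g ⊢ q [ xs ]⇓ y) qs ys →
       Pointwise (λ q y → g ⊢ q [ xs ]⇓ y)
         (Vec.map (λ q → comp (predʳ (var 0F) .program) (q ∷ [])) qs) (Vec.map pred ys)
  go []       = []
  go (d ∷ ds) = comp (d ∷ []) (predʳ (var 0F) .computes g _) ∷ go ds

mutual
  approxʳ : (p : Program n) → Recursive (λ _ xs → approx p (head xs) (tail xs))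
  approxʳ zero   = const 1
  approxʳ suc    = recursive-≗ (λ { _ (_ ∷ _ ∷ []) → refl }) (sucʳ (sucʳ (var 1F)))
  approxʳ (proj i) = recursive-≗ (λ { _ (_ ∷ _) → refl }) (sucʳ (var (suc i)))
  approxʳ oracle = recursive-≗ (λ { _ (_ ∷ _ ∷ []) → refl }) (entryʳ (var 0F) (var 1F))
  approxʳ (comp p qs) = recursive-≗ (λ { _ (_ ∷ _) → refl })
    (sgnʳ (definedʳ (approxsʳ qs)) *ʳ (approxʳ p ⟦ var 0F ◂ predsʳ (approxsʳ qs) ⟧))
  approxʳ (rec p q) = recursive-≗ (λ { _ (_ ∷ _ ∷ _) → refl })
    (natrecʳ (var 1F) (approxʳ p ⟦ var 0F ◂ vars₂ ⟧)
      (sgnʳ (var 1F) *ʳ (approxʳ q ⟦ var 2F ◂ var 0F ◂ predʳ (var 1F) ◂ vars₂ ⟦ vars₂ ⟧ˢ ⟧)))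
  approxʳ (mu p) = recursive-≗ (λ { _ (_ ∷ _) → refl })
    (isZeroʳ (predʳ value) *ʳ (value *ʳ sucʳ k))
    where
    k = searchʳ (var 0F) (isZeroʳ (predʳ (approxʳ p ⟦ var 1F ◂ var 0F ◂ vars₂ ⟧)))
    value = approxʳ p ⟦ var 0F ◂ k ◂ vars₁ ⟧

  approxsʳ : (qs : Vec (Program n) m) → Recursives (λ _ xs → approxs qs (head xs) (tail xs))
  approxsʳ []       = ε
  approxsʳ (q ∷ qs) = approxʳ q ◂ approxsʳ qs

-- Convergence of the approximations

infix 4 _⊑_

-- A code plays two parts in `approx`: its entries answer the oracle queries and its size bounds the
-- searches. Both have to grow.
_⊑_ : ℕ → ℕ → Set
c ⊑ d = c ≤ d × (∀ i y → entry c i ≡ suc y → entry d i ≡ suc y)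

code-⊑ : ∀ g {m n} → m ≤ n → code (g ↾ m) ⊑ code (g ↾ n)
code-⊑ g {m} {n} m≤n = code-mono g m≤n , λ i y eq →
  let i<m , gi≡y = entry≡suc g m {i} eq
  in trans (entry-< g {i} (<-≤-trans i<m m≤n)) (cong suc gi≡y)

defined-suc : (ys : Vec ℕ n) → defined (Vec.map suc ys) ≡ 1
defined-suc []       = refl
defined-suc (y ∷ ys) = trans (*-identityˡ _) (defined-suc ys)

defined≡suc : (ys : Vec ℕ n) → ∀ {d} → defined ys ≡ suc d → ∃[ zs ] ys ≡ Vec.map suc zs
defined≡suc []       _  = [] , refl
defined≡suc (y ∷ ys) eq =
  let z  , y≡  , ds  = sgn*≡suc {y} eq
      zs , ys≡ = defined≡suc ys ds
  in z ∷ zs , cong₂ _∷_ y≡ ys≡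

map-pred-suc : (ys : Vec ℕ n) → Vec.map pred (Vec.map suc ys) ≡ ys
map-pred-suc []       = refl
map-pred-suc (y ∷ ys) = cong (y ∷_) (map-pred-suc ys)

module _ {p : Program m} {qs : Vec (Program n) m} {c : ℕ} {xs : Vec ℕ n} where

  approx-comp⁺ : ∀ {ys z} → approxs qs c xs ≡ Vec.map suc ys → approx p c ys ≡ suc z →
                 approx (comp p qs) c xs ≡ suc z
  approx-comp⁺ {ys} eqs eq rewrite eqs | defined-suc ys | map-pred-suc ys =
    trans (*-identityˡ _) eq

  approx-comp⁻ : ∀ {z} → approx (comp p qs) c xs ≡ suc z →
                 ∃[ ys ] approxs qs c xs ≡ Vec.map suc ys × approx p c ys ≡ suc z
  approx-comp⁻ eq =
    let d  , def , eq′ = sgn*≡suc {defined (approxs qs c xs)} eq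
        ys , eqs       = defined≡suc (approxs qs c xs) def
    in ys , eqs ,
       subst (λ zs → approx p c zs ≡ _) (trans (cong (Vec.map pred) eqs) (map-pred-suc ys)) eq′

module _ {p : Program n} {q : Program (2+ n)} {c : ℕ} {xs : Vec ℕ n} {k : ℕ} where

  approx-recS⁺ : ∀ {y z} → approx (rec p q) c (k ∷ xs) ≡ suc y →
                 approx q c (k ∷ y ∷ xs) ≡ suc z →
                 approx (rec p q) c (suc k ∷ xs) ≡ suc z
  approx-recS⁺ eq eq′ rewrite eq = trans (*-identityˡ _) eq′

  approx-recS⁻ : ∀ {z} → approx (rec p q) c (suc k ∷ xs) ≡ suc z →
                 ∃[ y ] approx (rec p q) c (k ∷ xs) ≡ suc y × approx q c (k ∷ y ∷ xs) ≡ suc z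
  approx-recS⁻ eq =
    let y , eq₁ , eq₂ = sgn*≡suc {approx (rec p q) c (k ∷ xs)} eq
    in y , eq₁ , subst (λ w → approx q c (k ∷ w ∷ xs) ≡ _) (cong pred eq₁) eq₂

module _ {p : Program (suc n)} {c : ℕ} {xs : Vec ℕ n} where

  private
    value : ℕ → ℕ
    value j = approx p c (j ∷ xs)

    stop : ℕ → ℕ
    stop j = isZero (pred (value j))

    found : ∀ w k {l} → isZero (pred w) * (w * suc k) ≡ suc l → w ≡ 1 × k ≡ l
    found 1 k eq = refl , suc-injective
      (trans (sym (trans (+-identityʳ _) (+-identityʳ _))) eq)

  approx-mu⁺ : ∀ {k} → k ≤ c → (∀ j → j < k → ∃[ y ] value j ≡ suc (suc y)) →
               value k ≡ 1 → approx (mu p) c xs ≡ suc k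
  approx-mu⁺ {k} k≤c below eq
    rewrite search≡ c stop {k} (λ e → isZero≡0 e (cong pred eq))
              (λ j j<k → cong (isZero ∘ pred) (proj₂ (below j j<k))) k≤c
          | eq = trans (+-identityʳ _) (+-identityʳ _)

  approx-mu⁻ : ∀ {k} → approx (mu p) c xs ≡ suc k →
               k ≤ c × (∀ j → j < k → ∃[ y ] value j ≡ suc (suc y)) × value k ≡ 1
  approx-mu⁻ eq with found (value (search c stop)) (search c stop) eq
  ... | v≡1 , refl = search≤ c stop , below , v≡1
    where
    below : ∀ j → j < search c stop → ∃[ y ] value j ≡ suc (suc y)
    below j j<s =
      let y , eq = ≢0⇒suc (isZero≡0 (<search c stop j<s))
      in y , pred≡suc eq
      where
      pred≡suc : ∀ {a b} → pred a ≡ suc b → a ≡ suc (suc b)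
      pred≡suc {suc a} eq = cong suc eq

mutual
  approx-mono : ∀ {c d} → c ⊑ d → ∀ (p : Program n) {xs y} →
                approx p c xs ≡ suc y → approx p d xs ≡ suc y
  approx-mono c⊑d zero eq = eq
  approx-mono c⊑d suc {x ∷ []} eq = eq
  approx-mono c⊑d (proj i) eq = eq
  approx-mono c⊑d oracle {x ∷ []} eq = proj₂ c⊑d x _ eq
  approx-mono {c = c} c⊑d (comp p qs) eq =
    let ys , eqs , eq′ = approx-comp⁻ {p = p} {qs} eq
    in approx-comp⁺ {p = p} {qs} (approxs-mono c⊑d qs eqs) (approx-mono c⊑d p eq′)
  approx-mono c⊑d (rec p q) {zero ∷ xs} eq = approx-mono c⊑d p eq
  approx-mono c⊑d (rec p q) {suc k ∷ xs} eq =
    let y , eq₁ , eq₂ = approx-recS⁻ {p = p} {q} {k = k} eq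
    in approx-recS⁺ {p = p} {q} {k = k}
         (approx-mono c⊑d (rec p q) {k ∷ xs} eq₁) (approx-mono c⊑d q eq₂)
  approx-mono c⊑d (mu p) eq =
    let k≤c , below , eq′ = approx-mu⁻ {p = p} eq
    in approx-mu⁺ {p = p} (≤-trans k≤c (proj₁ c⊑d))
         (λ j j<k → proj₁ (below j j<k) , approx-mono c⊑d p (proj₂ (below j j<k)))
         (approx-mono c⊑d p eq′)

  approxs-mono : ∀ {c d} → c ⊑ d → ∀ (qs : Vec (Program n) m) {xs ys} →
                 approxs qs c xs ≡ Vec.map suc ys → approxs qs d xs ≡ Vec.map suc ys
  approxs-mono c⊑d [] {ys = []} eq = refl
  approxs-mono c⊑d (q ∷ qs) {ys = y ∷ ys} eq =
    cong₂ _∷_ (approx-mono c⊑d q (proj₁ (∷-injective eq)))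
              (approxs-mono c⊑d qs (proj₂ (∷-injective eq)))

module _ {g : Baire} {N : ℕ} where

  private c = code (g ↾ N)

  mutual
    approx-sound : ∀ (p : Program n) {xs y} → approx p c xs ≡ suc y → g ⊢ p [ xs ]⇓ y
    approx-sound zero {[]} refl = zero
    approx-sound suc {x ∷ []} refl = suc
    approx-sound (proj i) refl = proj
    approx-sound oracle {x ∷ []} eq =
      subst (g ⊢ oracle [ x ∷ [] ]⇓_) (proj₂ (entry≡suc g N eq)) oracle
    approx-sound (comp p qs) eq =
      let ys , eqs , eq′ = approx-comp⁻ {p = p} {qs} eq
      in comp (approxs-sound qs eqs) (approx-sound p eq′)
    approx-sound (rec p q) {zero ∷ xs} eq = rec0 (approx-sound p eq)
    approx-sound (rec p q) {suc k ∷ xs} eq =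
      let y , eq₁ , eq₂ = approx-recS⁻ {p = p} {q} {k = k} eq
      in recS (approx-sound (rec p q) {k ∷ xs} eq₁) (approx-sound q eq₂)
    approx-sound (mu p) eq =
      let _ , below , eq′ = approx-mu⁻ {p = p} eq
      in mu (λ j j<k → proj₁ (below j j<k) , approx-sound p (proj₂ (below j j<k)))
            (approx-sound p eq′)

    approxs-sound : ∀ (qs : Vec (Program n) m) {xs ys} →
                    approxs qs c xs ≡ Vec.map suc ys →
                    Pointwise (λ q y → g ⊢ q [ xs ]⇓ y) qs ys
    approxs-sound [] {ys = []} eq = []
    approxs-sound (q ∷ qs) {ys = y ∷ ys} eq =
      approx-sound q (proj₁ (∷-injective eq)) ∷ approxs-sound qs (proj₂ (∷-injective eq))

-- Bounded collection. It gives a common stage to the computations that precede the value of a `mu`,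
-- and later a common bound to finitely many indices.
bounded : ∀ k {P : ℕ → ℕ → Set} → (∀ {j M N} → M ≤ N → P j M → P j N) →
          (∀ j → j < k → ∃[ N ] P j N) → ∃[ N ] (∀ j → j < k → P j N)
bounded zero    _    _ = 0 , λ _ ()
bounded (suc k) {P} mono p = M ⊔ N , all
  where
  M = proj₁ (bounded k {P} mono (λ j j<k → p j (m<n⇒m<1+n j<k)))
  N = proj₁ (p k ≤-refl)
  all : ∀ j → j < suc k → P j (M ⊔ N)
  all j j<1+k with m≤n⇒m<n∨m≡n (s≤s⁻¹ j<1+k)
  ... | inj₁ j<k  =
    mono (m≤m⊔n M N) (proj₂ (bounded k {P} mono (λ j j<k → p j (m<n⇒m<1+n j<k))) j j<k)
  ... | inj₂ refl = mono (m≤n⊔m M N) (proj₂ (p k ≤-refl))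

module _ (g : Baire) where

  private
    later : ∀ {M N} (p : Program n) {xs y} → M ≤ N →
            approx p (code (g ↾ M)) xs ≡ suc y → approx p (code (g ↾ N)) xs ≡ suc y
    later p M≤N = approx-mono (code-⊑ g M≤N) p

  mutual
    approx-complete : ∀ {p : Program n} {xs y} → g ⊢ p [ xs ]⇓ y →
                      ∃[ N ] approx p (code (g ↾ N)) xs ≡ suc y
    approx-complete zero = 0 , refl
    approx-complete suc  = 0 , refl
    approx-complete proj = 0 , refl
    approx-complete (oracle {x}) = suc x , entry-< g ≤-refl
    approx-complete (comp {p = p} {qs} ds d) =
      let M , eqs = approxs-complete ds
          N , eq  = approx-complete d
      in M ⊔ N , approx-comp⁺ {p = p} {qs}
           (approxs-mono (code-⊑ g (m≤m⊔n M N)) qs eqs) (later p (m≤n⊔m M N) eq)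
    approx-complete (rec0 d) = approx-complete d
    approx-complete (recS {p = p} {q} {k} {xs} d e) =
      let M , eq  = approx-complete d
          N , eq′ = approx-complete e
      in M ⊔ N , approx-recS⁺ {p = p} {q} {k = k}
           (later (rec p q) {k ∷ xs} (m≤m⊔n M N) eq) (later q (m≤n⊔m M N) eq′)
    approx-complete (mu {p = p} {xs} {k} ds d) =
      let M , below = bounded k
            {λ j N → ∃[ y ] approx p (code (g ↾ N)) (j ∷ xs) ≡ suc (suc y)}
            (λ M≤N (y , eq) → y , later p M≤N eq)
            (λ j j<k → let y , e = ds j j<k ; N , eq = approx-complete e in N , y , eq)
          N , eq = approx-complete d
          -- `k` takes part in the maximum so that the code of the prefix, being at least its
          -- length, allows the search to reach `k`.
          L = k ⊔ (M ⊔ N)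
      in L , approx-mu⁺ {p = p}
           (≤-trans (m≤m⊔n k (M ⊔ N)) (n≤code g L))
           (λ j j<k → let y , e = below j j<k
                      in y , later p (≤-trans (m≤m⊔n M N) (m≤n⊔m k (M ⊔ N))) e)
           (later p (≤-trans (m≤n⊔m M N) (m≤n⊔m k (M ⊔ N))) eq)

    approxs-complete : ∀ {qs : Vec (Program n) m} {xs ys} →
                       Pointwise (λ q y → g ⊢ q [ xs ]⇓ y) qs ys →
                       ∃[ N ] approxs qs (code (g ↾ N)) xs ≡ Vec.map suc ys
    approxs-complete [] = 0 , refl
    approxs-complete {qs = q ∷ qs} (d ∷ ds) =
      let M , eq  = approx-complete d
          N , eqs = approxs-complete ds
      in M ⊔ N , cong₂ _∷_ (later q (m≤m⊔n M N) eq)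
                           (approxs-mono (code-⊑ g (m≤n⊔m M N)) qs eqs)

-- A homogeneous class whose elements compute elements of a given class

-- Nodes of the full binary tree: 1 is the root and b + 2 * v is the child of
-- v in direction b.
descend : ℕ → Baire → ℕ → ℕ
descend v a i = natrec v (λ j u → a j + 2 * u) i

-- The leading binary digit 1 of a node stands for the root, which preserves the zeros at the
-- beginning of a path. The first argument is the predecessor of a halved node: it is 0 at the root
-- and beyond, where no direction is recorded.
push : ℕ → ℕ → List ℕ → List ℕ
push zero    b σ = σ
push (suc _) b σ = b ∷ σ

bits : ℕ → ℕ → List ℕ
bits zero    v = []
bits (suc i) v = push (pred (halves i v)) (parity (halves i v)) (bits i v)

opaque
  -- The path from the root to v; bits adds nothing once the root is reached.
  string : ℕ → List ℕ
  string v = bits v v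

  stringʳ : {f : Baire → Vec ℕ n → ℕ} → Recursive f → Recursive (λ g xs → code (string (f g xs)))
  stringʳ {f = f} r = let halves′ = halvesʳ (var 0F) (r ⟦ vars₂ ⟧) in
    recursive-≗ (λ g xs → bits-code (f g xs) (f g xs))
      (natrecʳ r (const 0) (ifzʳ (predʳ halves′) (var 1F) (consʳ (parityʳ halves′) (var 1F))))
    where
    push-code : ∀ k b σ → ifz k (code σ) (cons b (code σ)) ≡ code (push k b σ)
    push-code zero    b σ = refl
    push-code (suc _) b σ = refl
    bits-code : ∀ i v →
      natrec 0 (λ i c → ifz (pred (halves i v)) c (cons (parity (halves i v)) c)) i ≡ code (bits i v)
    bits-code zero    v = refl
    bits-code (suc i) v =
      trans (cong (λ c → ifz (pred (halves i v)) c (cons (parity (halves i v)) c)) (bits-code i v))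
        (push-code (pred (halves i v)) (parity (halves i v)) (bits i v))

descend-cong : ∀ v {a b} k → (∀ i → i < k → a i ≡ b i) → descend v a k ≡ descend v b k
descend-cong v zero    p = refl
descend-cong v (suc k) p =
  cong₂ (λ x u → x + 2 * u) (p k ≤-refl) (descend-cong v k (λ i i<k → p i (m<n⇒m<1+n i<k)))

descend-suc : ∀ v a k → descend (a 0 + 2 * v) (a ∘ suc) k ≡ descend v a (suc k)
descend-suc v a zero    = refl
descend-suc v a (suc k) = cong (λ u → a (suc k) + 2 * u) (descend-suc v a k)

module _ {y : Baire} (y∈ : Cantor y) where

  private
    node : ℕ → ℕ
    node = descend 1 y

    node>n : ∀ n → n < node n
    node>n zero    = s≤s z≤n
    node>n (suc n) = ≤-trans
      (≤-trans (≤-reflexive (cong suc (sym (+-comm n 1))))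
        (+-mono-≤ (node>n n) (≤-trans (≤-trans (s≤s z≤n) (node>n n)) (m≤m+n (node n) 0))))
      (m≤n+m (2 * node n) (y n))

    halves-node : ∀ i m {k} → m + i ≡ k → halves i (node k) ≡ node m
    halves-node zero m refl = cong node (+-identityʳ m)
    halves-node (suc i) m eq =
      trans (cong half (halves-node i (suc m) (trans (sym (+-suc m i)) eq)))
        (half-bit (y m) (node m) (y∈ m))

    bits-node : ∀ i m {k} → m + i ≡ k → bits i (node k) ≡ (λ j → y (m + j)) ↾ i
    bits-node zero    m eq = refl
    bits-node (suc i) m {k} eq
      rewrite halves-node i (suc m) {k} (trans (sym (+-suc m i)) eq)
            | proj₂ (≢0⇒suc (m<n⇒n≢0 (pred-mono-< (node>n (suc m)))))
            = cong₂ _∷_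
                (trans (parity-bit (y m) (node m) (y∈ m)) (cong y (sym (+-identityʳ m))))
                (trans (bits-node i (suc m) (trans (sym (+-suc m i)) eq))
                  (↾-cong i (λ j _ → cong y (sym (+-suc m j)))))

    halves-root : ∀ n k → halves (k + n) (node n) ≤ 1
    halves-root n zero    = ≤-reflexive (halves-node n 0 refl)
    halves-root n (suc k) = ≤-trans (half≤ _) (halves-root n k)

    bits-stable : ∀ n k → bits (k + n) (node n) ≡ bits n (node n)
    bits-stable n zero = refl
    bits-stable n (suc k) with halves (k + n) (node n) | halves-root n k
    ... | zero  | _ = bits-stable n k
    ... | 1     | _ = bits-stable n k
    ... | 2+ _  | s≤s ()

  opaque
    unfolding string

    string-descend : ∀ n → string (descend 1 y n) ≡ y ↾ n
    string-descend n =
      trans (cong (λ i → bits i (node n)) (sym (m∸n+n≡m (<⇒≤ (node>n n)))))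
        (trans (bits-stable n (node n ∸ n)) (bits-node n 0 refl))

bit : ℕ → Baire
bit t i = parity (halves i t)

-- Turns the quantifier over paths of length `s` into one over numbers below `2 ^ s`, which makes
-- survival to level `s` computable.
bits-of : ∀ {a} → Cantor a → ∀ s → ∃[ t ] t < 2 ^ s × (∀ i → i < s → bit t i ≡ a i)
bits-of a∈ zero = 0 , s≤s z≤n , λ _ ()
bits-of {a} a∈ (suc s) =
  let t , t< , eq = bits-of {a ∘ suc} (a∈ ∘ suc) s
  in a 0 + 2 * t
   , ≤-trans (s≤s (+-monoˡ-≤ (2 * t) (s≤s⁻¹ (a∈ 0))))
       (≤-trans (≤-reflexive (sym (*-suc 2 t))) (*-monoʳ-≤ 2 t<))
   , λ { zero    _ → parity-bit (a 0) t (a∈ 0)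
       ; (suc i) i<s → trans (cong parity (trans (halves-suc i _) (cong (halves i) (half-bit (a 0) t (a∈ 0)))))
                         (eq i (s≤s⁻¹ i<s)) }

-- The homogeneous class of a computable tree

module Homogeneous {R : List ℕ → ℕ} (computable : Computable R) where

  -- Levels are counted from `v`, and `R` is tested at `v` itself (`i = 0`) but not at its
  -- ancestors. Level 0 therefore says exactly that `R` vanishes at `v`.
  Alive : ℕ → ℕ → Set
  Alive v s = ∃[ a ] Cantor a × (∀ i → i ≤ s → R (string (descend v a i)) ≡ 0)

  opaque
    alive : ℕ → ℕ → ℕ
    alive v s = ∑ (2 ^ s) λ t → isZero (∑ (suc s) λ i → R (string (descend v (bit t) i)))

    aliveʳ : {v s : Baire → Vec ℕ n → ℕ} → Recursive v → Recursive s →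
             Recursive (λ g xs → alive (v g xs) (s g xs))
    aliveʳ r r′ = go ⟦ r ◂ r′ ◂ ε ⟧
      where
      go : Recursive (λ _ (xs : Vec ℕ 2) → alive (lookup xs 0F) (lookup xs 1F))
      go = ∑ʳ (2^ʳ (var 1F)) (isZeroʳ (∑ʳ (sucʳ (var 2F))
        (computableʳ computable
          {σ = λ _ xs → string (descend (lookup xs 2F) (bit (lookup xs 1F)) (lookup xs 0F))} (stringʳ
          (natrecʳ (var 0F) (var 2F)
            (parityʳ (halvesʳ (var 0F) (var 3F)) +ʳ const 2 *ʳ var 1F))))))

    alive⇒Alive : ∀ {v s} → alive v s ≢ 0 → Alive v s
    alive⇒Alive {v} {s} p =
      let t , _ , q = ∑≢0⇒ (2 ^ s) p
      in bit t , (λ i → parity<2 (halves i t))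
       , λ i i≤s → ∑≡0⇒ (suc s) {λ i → R (string (descend v (bit t) i))} (isZero≢0 q) (s≤s i≤s)

    Alive⇒alive : ∀ {v s} → Alive v s → alive v s ≢ 0
    Alive⇒alive {v} {s} (a , a∈ , p) =
      let t , t< , eq = bits-of a∈ s
      in ⇒∑≢0 (2 ^ s) t< λ z → isZero≡0 z
           (⇒∑≡0 (suc s) {λ i → R (string (descend v (bit t) i))} λ i i<1+s →
           trans (cong (R ∘ string) (descend-cong v i (λ j j<i → eq j (≤-trans j<i (s≤s⁻¹ i<1+s)))))
             (p i (s≤s⁻¹ i<1+s)))

  Alive-antitone : ∀ {v s t} → s ≤ t → Alive v t → Alive v s
  Alive-antitone s≤t (a , a∈ , p) = a , a∈ , λ i i≤s → p i (≤-trans i≤s s≤t)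

  Alive-child : ∀ {v s} → Alive v (suc s) → ∃[ b ] b < 2 × Alive (b + 2 * v) s
  Alive-child {v} (a , a∈ , p) = a 0 , a∈ 0 , a ∘ suc , a∈ ∘ suc ,
    λ i i≤s → trans (cong (R ∘ string) (descend-suc v a i)) (p (suc i) (s≤s i≤s))

  opaque
    -- Choosing b at the node v is bad if, at some level s, the subtree in
    -- direction b has died out while its sibling has not. Values b ≥ 2 are
    -- always bad.
    bad : ℕ → ℕ → ℕ → ℕ
    bad v b s = isZero (alive (b + 2 * v) s) * alive ((1 ∸ b) + 2 * v) s + (b ∸ 1)

    badʳ : {v b s : Baire → Vec ℕ n → ℕ} → Recursive v → Recursive b → Recursive s →
           Recursive (λ g xs → bad (v g xs) (b g xs) (s g xs))
    badʳ r s t = isZeroʳ (aliveʳ (s +ʳ const 2 *ʳ r) t) *ʳ aliveʳ (const 1 ∸ʳ s +ʳ const 2 *ʳ r) t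
                 +ʳ (s ∸ʳ const 1)

  Good : ℕ → ℕ → Set
  Good v b = ∀ s → bad v b s ≡ 0

  opaque
    unfolding bad

    Good⇒<2 : ∀ {v b} → Good v b → b < 2
    Good⇒<2 {v} {b} good = s≤s (m∸n≡0⇒m≤n (m+n≡0⇒n≡0 (isZero (alive (b + 2 * v) 0) * _) (good 0)))

    -- If the chosen child were dead at level `s`, goodness would make its sibling dead there as
    -- well. As there are only two directions, `v` would then be dead at level `suc s`.
    good-child-alive : ∀ {v b} → Good v b → (∀ s → Alive v s) → ∀ s → Alive (b + 2 * v) s
    good-child-alive {v} {b} good immortal s with alive (b + 2 * v) s ≟ 0
    ... | no  live = alive⇒Alive live
    ... | yes dead =
      let b′ , b′<2 , alive-b′ = Alive-child (immortal (suc s))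
      in contradiction (Alive⇒alive alive-b′) λ live → live (both-dead b′ b′<2)
      where
      sibling-dead : alive ((1 ∸ b) + 2 * v) s ≡ 0
      sibling-dead = trans (sym (*-identityˡ _))
        (subst (λ z → isZero z * alive ((1 ∸ b) + 2 * v) s ≡ 0) dead
          (m+n≡0⇒m≡0 (isZero (alive (b + 2 * v) s) * _) (good s)))
      choice : ∀ {b b′} → b < 2 → b′ < 2 → b′ ≡ b ⊎ b′ ≡ 1 ∸ b
      choice {0} {0} _ _ = inj₁ refl
      choice {0} {1} _ _ = inj₂ refl
      choice {1} {0} _ _ = inj₂ refl
      choice {1} {1} _ _ = inj₁ refl
      choice {2+ _}  (s≤s (s≤s ())) _
      choice {_} {2+ _} _ (s≤s (s≤s ()))
      both-dead : ∀ b′ → b′ < 2 → alive (b′ + 2 * v) s ≡ 0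
      both-dead b′ b′<2 with choice (Good⇒<2 {v} {b} good) b′<2
      ... | inj₁ refl = dead
      ... | inj₂ refl = sibling-dead

    -- Suppose direction 0 is dead at `s` with its sibling alive, and direction 1 is dead at `t`
    -- with its sibling alive. Liveness is inherited by earlier levels, so at the smaller of the two
    -- levels one direction is both dead and alive.
    good-choice : ExcludedMiddle 0ℓ → ∀ v → ∃[ b ] Good v b
    good-choice em v with em {∃[ s ] bad v 0 s ≢ 0}
    ... | no  fine = 0 , λ s → case bad v 0 s ≟ 0 of λ
      { (yes eq) → eq ; (no neq) → contradiction (s , neq) fine }
    ... | yes (s , bad₀) = 1 , λ t → case bad v 1 t ≟ 0 of λ
      { (yes eq) → eq ; (no bad₁) → contradiction (clash t bad₁) λ () }
      where
      dead-alive : ∀ {a b} → isZero a * b + 0 ≢ 0 → a ≡ 0 × b ≢ 0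
      dead-alive {a} {b} p =
        let q , r = *≢0 {isZero a} {b} λ eq → p (trans (+-identityʳ _) eq) in isZero≢0 q , r
      clash : ∀ t → bad v 1 t ≢ 0 → 0 ≡ 1
      clash t bad₁ with dead-alive bad₀ | dead-alive bad₁ | ≤-total s t
      ... | d₀ , a₁ | d₁ , a₀ | inj₁ s≤t =
        contradiction d₀ (Alive⇒alive {0 + 2 * v} {s} (Alive-antitone {0 + 2 * v} s≤t (alive⇒Alive a₀)))
      ... | d₀ , a₁ | d₁ , a₀ | inj₂ t≤s =
        contradiction d₁ (Alive⇒alive {1 + 2 * v} {t} (Alive-antitone {1 + 2 * v} t≤s (alive⇒Alive a₁)))

  opaque
    -- Stage c of the search for a bad value among those suc (w v), v < c,
    -- that are defined, 0 standing for undefined values.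
    faults : (ℕ → ℕ) → ℕ → ℕ
    faults w c = ∑ c λ v → ∑ c λ s → sgn (w v) * bad v (pred (w v)) s

    faultsʳ : {w : Baire → Vec ℕ (suc n) → ℕ} {c : Baire → Vec ℕ n → ℕ} →
              Recursive w → Recursive c →
              Recursive (λ g xs → faults (λ v → w g (v ∷ xs)) (c g xs))
    faultsʳ r s = ∑ʳ s (∑ʳ (s ⟦ vars₁ ⟧)
      (sgnʳ (r ⟦ vars₁ ⟧) *ʳ badʳ (var 1F) (predʳ (r ⟦ vars₁ ⟧)) (var 0F)))

    faults⁺ : ∀ w {c v b s} → v < c → s < c → w v ≡ suc b → bad v b s ≢ 0 → faults w c ≢ 0
    faults⁺ w {c} {v} {b} {s} v<c s<c eq p = ⇒∑≢0 c v<c (⇒∑≢0 c s<c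
      (subst (λ z → sgn z * bad v (pred z) s ≢ 0) (sym eq) (λ z → p (trans (sym (*-identityˡ _)) z))))

    faults⁻ : ∀ w {c} → faults w c ≢ 0 →
              ∃[ v ] ∃[ s ] ∃[ b ] v < c × s < c × w v ≡ suc b × bad v b s ≢ 0
    faults⁻ w {c} p =
      let v , v<c , q = ∑≢0⇒ c p
          s , s<c , r = ∑≢0⇒ c q
          sg , bd = *≢0 {sgn (w v)} r
          b , eq = ≢0⇒suc {w v} (λ eq → sg (cong sgn eq))
      in v , s , b , v<c , s<c , eq , subst (λ z → bad v (pred z) s ≢ 0) eq bd

  Class : Pred Baire 0ℓ
  Class x = ∀ v → Good v (x v)

  -- A fault of `x` is visible from a single entry and a single level, so a long enough prefix
  -- reveals it. The code of the prefix also serves as the stage of the test, being at least the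
  -- length of the prefix.
  class : ExcludedMiddle 0ℓ → NonemptyΠ⁰₁Class Class
  class em = record
    { binary   = λ {x} x∈ v → Good⇒<2 {v} {x v} (x∈ v)
    ; isΠ⁰₁    = test , (test-recursive .program , λ g σ → test-recursive .computes g (code σ ∷ []))
               , λ x → mk⇔ (sound x) (complete x)
    ; nonempty = (λ v → proj₁ (good-choice em v)) , λ v → proj₂ (good-choice em v)
    }
    where
    test : List ℕ → ℕ
    test σ = faults (entry (code σ)) (code σ)
    test-recursive : Recursive (λ _ (xs : Vec ℕ 1) → faults (entry (lookup xs 0F)) (lookup xs 0F))
    test-recursive = faultsʳ (entryʳ (var 1F) (var 0F)) (var 0F)
    sound : ∀ x → Class x → ∀ n → test (x ↾ n) ≡ 0
    sound x x∈ n with test (x ↾ n) ≟ 0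
    ... | yes eq = eq
    ... | no neq =
      let v , s , b , _ , _ , eq , p = faults⁻ (entry (code (x ↾ n))) {code (x ↾ n)} neq
      in contradiction (subst (λ b → bad v b s ≡ 0) (proj₂ (entry≡suc x n {v} eq)) (x∈ v s)) p
    complete : ∀ x → (∀ n → test (x ↾ n) ≡ 0) → Class x
    complete x p v s with bad v (x v) s ≟ 0
    ... | yes eq = eq
    ... | no neq = contradiction (p N) (faults⁺ (entry (code (x ↾ N)))
                     (≤-trans (s≤s (m≤m⊔n v s)) (n≤code x N))
                     (≤-trans (s≤s (m≤n⊔m v s)) (n≤code x N))
                     (entry-< x {v} {N} (s≤s (m≤m⊔n v s))) neq)
      where N = suc (v ⊔ s)

  branchNode : Baire → ℕ → ℕ
  branchNode x n = natrec 1 (λ _ v → x v + 2 * v) n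

  branch : Baire → Baire
  branch x n = x (branchNode x n)

  -- The root is alive at all levels because Q has an element, and good directions preserve this.
  -- Level 0 then gives `R ≡ 0` at every node of the branch, so compactness is avoided.
  branch-sound : ∀ {Q : Pred Baire 0ℓ} → (∀ g → Q g ⇔ (∀ n → R (g ↾ n) ≡ 0)) →
                 (∀ {g} → Q g → Cantor g) → Satisfiable Q →
                 ∀ {x} → Class x → Q (branch x)
  branch-sound {Q} Q⇔ binary (q , q∈) {x} x∈ = Equivalence.from (Q⇔ (branch x)) λ n →
    trans (cong R (trans (sym (string-descend branch∈ n)) (cong string (sym (branchNode≡ n)))))
      (proj₂ (proj₂ (immortal n 0)) 0 z≤n)
    where
    branch∈ : Cantor (branch x)
    branch∈ n = Good⇒<2 {branchNode x n} {branch x n} (x∈ _)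
    branchNode≡ : ∀ n → branchNode x n ≡ descend 1 (branch x) n
    branchNode≡ zero    = refl
    branchNode≡ (suc n) = cong (λ u → branch x n + 2 * u) (branchNode≡ n)
    immortal : ∀ n s → Alive (branchNode x n) s
    immortal zero    s = q , binary q∈ , λ i _ →
      trans (cong R (string-descend (binary q∈) i)) (Equivalence.to (Q⇔ q) q∈ i)
    immortal (suc n) s =
      good-child-alive {branchNode x n} {branch x n} (x∈ _) (immortal n) s

-- Counting distinct values and changes of sequences

pigeonhole : ∀ {xs ys : List ℕ} → Unique xs → All (Membership._∈ ys) xs → length xs ≤ length ys
pigeonhole [] [] = z≤n
pigeonhole {x ∷ xs} {ys} (x∉xs ∷ unique) (x∈ys ∷ xs⊆ys) = ≤-trans
  (s≤s (pigeonhole unique (All.zipWith (λ (x≢y , y∈ys) → ∈-filter⁺ other? y∈ys (x≢y ∘ sym)) (x∉xs , xs⊆ys))))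
  (filter-notAll other? ys (Any.map (λ x≡y y≢x → y≢x (sym x≡y)) x∈ys))
  where other? = λ y → ¬? (y ≟ x)

AtMost-⊆ : ∀ {k} {S T : ℕ → Set} → (∀ {n} → S n → T n) → AtMost k T → AtMost k S
AtMost-⊆ S⊆T bound ns unique all = bound ns unique (All.map S⊆T all)

-- Each change is a strict increase, so `f` is injective on the stages where it changes, and its
-- values there are below `b`.
increases-bounded : ∀ {f : ℕ → ℕ} {b} → (∀ {m n} → m ≤ n → f m ≤ f n) → (∀ n → f n ≤ b) →
                    AtMost b (λ n → f (suc n) ≢ f n)
increases-bounded {f} {b} mono f≤b ns unique changes = subst₂ _≤_ (length-map f ns) (length-upTo b)
  (pigeonhole (values ns unique changes) (below ns changes))
  where
  increase : ∀ {n} → f (suc n) ≢ f n → f n < f (suc n)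
  increase {n} f≢ = ≤∧≢⇒< (mono (n≤1+n n)) (f≢ ∘ sym)
  separate : ∀ {m n} → m ≢ n → f (suc m) ≢ f m → f (suc n) ≢ f n → f m ≢ f n
  separate {m} {n} m≢n p q with <-cmp m n
  ... | tri< m<n _ _ = <⇒≢ (<-≤-trans (increase p) (mono m<n))
  ... | tri≈ _ m≡n _ = contradiction m≡n m≢n
  ... | tri> _ _ n<m = ≢-sym (<⇒≢ (<-≤-trans (increase q) (mono n<m)))
  values : ∀ ns → Unique ns → All (λ n → f (suc n) ≢ f n) ns → Unique (List.map f ns)
  values [] _ _ = []
  values (n ∷ ns) (n∉ns ∷ unique) (p ∷ ps) = away n∉ns ps ∷ values ns unique ps
    where
    away : ∀ {ms} → All (n ≢_) ms → All (λ n → f (suc n) ≢ f n) ms → All (f n ≢_) (List.map f ms)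
    away [] [] = []
    away (n≢m ∷ rest) (q ∷ qs) = separate n≢m p q ∷ away rest qs
  below : ∀ ns → All (λ n → f (suc n) ≢ f n) ns → All (Membership._∈ upTo b) (List.map f ns)
  below [] [] = []
  below (n ∷ ns) (p ∷ ps) = ∈-upTo⁺ (<-≤-trans (increase p) (f≤b (suc n))) ∷ below ns ps

-- Every value is either `ψ 0`, which accounts for the successor, or appears immediately after a
-- change.
changes-bound-values : ∀ (ψ : ℕ → ℕ) {k} → AtMost k (λ n → ψ (suc n) ≢ ψ n) →
                       AtMost (suc k) (λ e → ∃[ n ] ψ n ≡ e)
changes-bound-values ψ {k} bound es unique guesses = ≤-trans
  (pigeonhole unique (All.map (λ { (n , n≤N , refl) → listed N n n≤N }) (proj₂ (uniform guesses))))
  (s≤s (≤-trans (≤-reflexive (length-map (ψ ∘ suc) (changes N)))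
    (bound (changes N) (filter⁺ change? (upTo⁺ N)) (all-filter change? (upTo N)))))
  where
  change? = λ n → ¬? (ψ (suc n) ≟ ψ n)
  changes = λ N → filter change? (upTo N)
  uniform : ∀ {es} → All (λ e → ∃[ n ] ψ n ≡ e) es → ∃[ N ] All (λ e → ∃[ n ] n ≤ N × ψ n ≡ e) es
  uniform [] = 0 , []
  uniform ((n , eq) ∷ all) =
    let N , all′ = uniform all
    in n ⊔ N , (n , m≤m⊔n n N , eq)
       ∷ All.map (λ (m , m≤N , eq) → m , ≤-trans m≤N (m≤n⊔m n N) , eq) all′
  N = proj₁ (uniform guesses)
  listed : ∀ N n → n ≤ N → ψ n Membership.∈ (ψ 0 ∷ List.map (ψ ∘ suc) (changes N))
  listed N zero    _ = here refl
  listed N (suc n) n<N with ψ (suc n) ≟ ψ n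
  ... | yes eq = subst (Membership._∈ (ψ 0 ∷ List.map (ψ ∘ suc) (changes N))) (sym eq) (listed N n (<⇒≤ n<N))
  ... | no neq = there (∈-map⁺ (ψ ∘ suc) (∈-filter⁺ change? (∈-upTo⁺ n<N) neq))

-- Ranking values by first occurrence

equals : ℕ → ℕ → ℕ
equals a b = isZero ((a ∸ b) + (b ∸ a))

equals⇒≡ : ∀ {a b} → equals a b ≢ 0 → a ≡ b
equals⇒≡ {a} {b} p = let eq = isZero≢0 {(a ∸ b) + (b ∸ a)} p in ≤-antisym
  (m∸n≡0⇒m≤n (m+n≡0⇒m≡0 (a ∸ b) eq)) (m∸n≡0⇒m≤n (m+n≡0⇒n≡0 (a ∸ b) eq))

equals-refl : ∀ a → equals a a ≡ 1
equals-refl a = cong (λ d → isZero (d + d)) (n∸n≡0 a)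

-- isNew ψ n ≢ 0 iff the value ψ n has not occurred before stage n, and
-- rank ψ n is the number of distinct values before stage n.
isNew rank : (ℕ → ℕ) → ℕ → ℕ
isNew ψ n = isZero (∑ n λ m → equals (ψ m) (ψ n))
rank ψ n = ∑ n (isNew ψ)

isNew≤1 : ∀ ψ n → isNew ψ n ≡ 0 ⊎ isNew ψ n ≡ 1
isNew≤1 ψ n with ∑ n (λ m → equals (ψ m) (ψ n))
... | zero  = inj₂ refl
... | suc _ = inj₁ refl

first-occurrence : ∀ ψ N → ∃[ n ] ψ n ≡ ψ N × isNew ψ n ≡ 1
first-occurrence ψ N =
  let n , _ , eq , below = least (λ n → isZero (equals (ψ n) (ψ N))) {N} (cong isZero (equals-refl (ψ N)))
      ψn≡ψN = equals⇒≡ (isZero≡0 eq)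
  in n , ψn≡ψN , cong isZero (⇒∑≡0 n {λ m → equals (ψ m) (ψ n)} λ m m<n →
       subst (λ e → equals (ψ m) e ≡ 0) (sym ψn≡ψN) (isZero≢0 (below m m<n)))

distinct-values : ∀ ψ n → ∃[ es ] length es ≡ rank ψ n × Unique es ×
                  All (λ e → ∃[ m ] m < n × ψ m ≡ e) es
distinct-values ψ zero = [] , refl , [] , []
distinct-values ψ (suc n) with distinct-values ψ n | isNew≤1 ψ n
... | es , len , unique , all | inj₁ old = es , trans len (sym (cong (_+ rank ψ n) old)) , unique ,
  All.map (λ (m , m<n , eq) → m , m<n⇒m<1+n m<n , eq) all
... | es , len , unique , all | inj₂ new = ψ n ∷ es
  , trans (cong suc len) (sym (cong (_+ rank ψ n) new))
  , All.map (λ { (m , m<n , refl) ψn≡ψm → 1+n≢0 (trans (sym (equals-refl (ψ n)))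
      (subst (λ e → equals e (ψ n) ≡ 0) (sym ψn≡ψm)
        (∑≡0⇒ n {λ m → equals (ψ m) (ψ n)}
          (isZero≢0 {∑ n (λ m → equals (ψ m) (ψ n))} (λ eq → 1+n≢0 (trans (sym new) eq))) m<n))) })
      all ∷ unique
  , (n , ≤-refl , refl) ∷ All.map (λ (m , m<n , eq) → m , m<n⇒m<1+n m<n , eq) all

rank-bounded : ∀ ψ {k n} → AtMost k (λ e → ∃[ m ] ψ m ≡ e) → isNew ψ n ≡ 1 → rank ψ n < k
rank-bounded ψ {k} {n} bound new =
  let es , len , unique , all = distinct-values ψ (suc n)
  in subst (_≤ k) (trans len (cong (_+ rank ψ n) new))
       (bound es unique (All.map (λ (m , _ , eq) → m , eq) all))

opaque
  bounded-monotone-converges : ExcludedMiddle 0ℓ → ∀ {f : ℕ → ℕ} {b} →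
    (∀ {m n} → m ≤ n → f m ≤ f n) → (∀ n → f n ≤ b) → ∃[ j ] f ⟶ j
  bounded-monotone-converges em {f} {b} mono f≤b =
    from b 0 (λ n _ → ≤-trans (f≤b n) (m≤n+m b (f 0)))
    where
    -- `d` bounds the growth still possible after `N`; excluded middle decides whether `f` grows
    -- again, and if so `d` drops.
    from : ∀ d N → (∀ n → N ≤ n → f n ≤ f N + d) → ∃[ j ] f ⟶ j
    from zero N p = f N , N , λ n N≤n →
      ≤-antisym (≤-trans (p n N≤n) (≤-reflexive (+-identityʳ (f N)))) (mono N≤n)
    from (suc d) N p with em {∃[ n ] N ≤ n × f N < f n}
    ... | yes (n , N≤n , fN<fn) = from d n λ m n≤m → ≤-trans (p m (≤-trans N≤n n≤m))
          (≤-trans (≤-reflexive (+-suc (f N) d)) (+-monoˡ-≤ d fN<fn))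
    ... | no ¬p = f N , N , λ n N≤n → ≤-antisym (≮⇒≥ (λ fN<fn → ¬p (n , N≤n , fN<fn))) (mono N≤n)

⟶-unique : ∀ {s d e} → s ⟶ d → s ⟶ e → d ≡ e
⟶-unique (M , p) (N , q) =
  trans (sym (p (M ⊔ N) (m≤m⊔n M N))) (q (M ⊔ N) (m≤n⊔m M N))

mu-least : {f : Baire → Vec ℕ (suc n) → ℕ} (r : Recursive f) → ∀ g xs {k} →
           f g (k ∷ xs) ≡ 0 → (∀ j → j < k → f g (j ∷ xs) ≢ 0) →
           g ⊢ mu (r .program) [ xs ]⇓ k
mu-least r g xs {k} eq below = mu
  (λ j j<k → let y , eq = ≢0⇒suc (below j j<k)
             in y , subst (g ⊢ r .program [ j ∷ xs ]⇓_) eq (r .computes g (j ∷ xs)))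
  (subst (g ⊢ r .program [ k ∷ xs ]⇓_) eq (r .computes g (k ∷ xs)))

table : (ℕ → ℕ) → ℕ → ℕ → ℕ
table f zero    j = f 0
table f (suc b) j = ifz j (f 0) (table (f ∘ suc) b (pred j))

table≡ : ∀ f {b j} → j ≤ b → table f b j ≡ f j
table≡ f {zero}  {zero}  _   = refl
table≡ f {suc b} {zero}  _   = refl
table≡ f {suc b} {suc j} j≤b = table≡ (f ∘ suc) (s≤s⁻¹ j≤b)

tableʳ : ∀ f b {j : Baire → Vec ℕ n → ℕ} → Recursive j → Recursive (λ g xs → table f b (j g xs))
tableʳ f zero    r = const (f 0)
tableʳ f (suc b) r = ifzʳ r (const (f 0)) (tableʳ (f ∘ suc) b (predʳ r))

-- Comparing the three notions of computability

module _ {Φ : ℕ → PartialFunction} (enumeration : EffectiveEnumeration Φ) where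

  open EffectiveEnumeration enumeration

  private
    u : Program 2
    u = proj₁ effective

    Φ⇒u : ∀ {e g h} → Graph (Φ e) g h → ∀ n → g ⊢ u [ e ∷ n ∷ [] ]⇓ h n
    Φ⇒u {e} {g} {h} = Equivalence.to (proj₂ effective e g h)

  index : Program 1 → ℕ
  index p = proj₁ (all ⟪ p ⟫ (p , λ _ _ → mk⇔ id id))

  Φ-index : ∀ {p g h} → (∀ n → g ⊢ p [ n ∷ [] ]⇓ h n) → Graph (Φ (index p)) g h
  Φ-index {p} {g} {h} =
    Equivalence.from (proj₂ (all ⟪ p ⟫ (p , λ _ _ → mk⇔ id id)) g h)

  boundedMindChanges⇒boundedGuesses : ∀ {Γ} → BoundedMindChanges Φ Γ → BoundedGuesses Φ Γ
  boundedMindChanges⇒boundedGuesses (Ψ , identifies , k , bound) =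
    Ψ , identifies , suc k , λ g g∈ → changes-bound-values (λ n → guess Ψ (g ↾ n)) (bound g g∈)

  module _ (Ψ : Learner) where

    private
      ψ : Baire → ℕ → ℕ
      ψ g n = guess Ψ (g ↾ n)

      ψʳ : {f : Baire → Vec ℕ n → ℕ} → Recursive f → Recursive (λ g xs → ψ g (f g xs))
      ψʳ {f = f} r = computableʳ (Learner.computable Ψ) {σ = λ g xs → g ↾ f g xs} (restrictionʳ r)

      rankʳ : {f : Baire → Vec ℕ n → ℕ} → Recursive f → Recursive (λ g xs → rank (ψ g) (f g xs))
      rankʳ r = ∑ʳ r (isZeroʳ (∑ʳ (var 0F)
        (isZeroʳ ((ψʳ (var 0F) ∸ʳ ψʳ (var 1F)) +ʳ (ψʳ (var 1F) ∸ʳ ψʳ (var 0F))))))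

      reached : ∀ i → Recursive (λ g (xs : Vec ℕ 2) → suc i ∸ rank (ψ g) (suc (lookup xs 0F)))
      reached i = const (suc i) ∸ʳ rankʳ (sucʳ (var 0F))

    -- Runs the guess of Ψ that is the i-th one to appear for the first time.
    nthGuess : ℕ → Program 1
    nthGuess i = comp u (comp (ψʳ (var {1} 0F) .program) (mu (reached i .program) ∷ []) ∷ proj 0F ∷ [])

    -- The search stops at `n` and no earlier: with `i` the rank of `n`, at most `i` values have
    -- been counted before, and the new value `ψ g n` is the one that exceeds `i`.
    nthGuess-computes : ∀ {g h n} → isNew (ψ g) n ≡ 1 → Graph (Φ (ψ g n)) g h →
                        ∀ m → g ⊢ nthGuess (rank (ψ g) n) [ m ∷ [] ]⇓ h m
    nthGuess-computes {g} {h} {n} new graph m =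
      comp (comp (mu-least (reached i) g (m ∷ []) {n} here′ below ∷ []) (ψʳ (var 0F) .computes g (n ∷ []))
            ∷ proj ∷ [])
        (Φ⇒u graph m)
      where
      i = rank (ψ g) n
      here′ : suc i ∸ rank (ψ g) (suc n) ≡ 0
      here′ = trans (cong (λ z → suc i ∸ (z + i)) new) (n∸n≡0 i)
      below : ∀ j → j < n → suc i ∸ rank (ψ g) (suc j) ≢ 0
      below j j<n = m<n⇒n≢0 (m<n⇒0<n∸m (s≤s (∑-monoˡ (isNew (ψ g)) j<n)))

  -- At its first occurrence the final guess is the i-th new one for some `i < k`. The programs
  -- `nthGuess Ψ i` do not depend on `g`, so their `k` indices have a common bound.
  boundedGuesses⇒boundedlyNonuniform : ∀ {Γ} → BoundedGuesses Φ Γ → BoundedlyNonuniform Φ Γ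
  boundedGuesses⇒boundedlyNonuniform (Ψ , identifies , k , bound) =
    proj₁ small , λ g h graph →
      let e , (N , limit) , Φe = identifies g h graph
          ψ = λ n → guess Ψ (g ↾ n)
          n , ψn≡ψN , new = first-occurrence ψ N
          ψn≡e = trans ψn≡ψN (limit N ≤-refl)
          i<k = rank-bounded ψ {n = n} (bound g (h , graph)) new
      in index (nthGuess Ψ (rank ψ n)) , proj₂ small _ i<k ,
         Φ-index (nthGuess-computes Ψ new (subst (λ e → Graph (Φ e) g h) (sym ψn≡e) Φe))
    where
    small = bounded k {λ i b → index (nthGuess Ψ i) < b} (λ M≤N i< → <-≤-trans i< M≤N)
              (λ i _ → suc (index (nthGuess Ψ i)) , ≤-refl)

  -- The largest partial function that `Ψ` identifies; identification then holds by definition.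
  learned : Learner → PartialFunction
  learned Ψ = record
    { Graph      = λ g h → ∃[ e ] ((λ n → guess Ψ (g ↾ n)) ⟶ e) × Graph (Φ e) g h
    ; resp       = (λ h≗k (e , limit , Φe) → e , limit , proj₁ (PartialFunction.resp (Φ e)) h≗k Φe)
                 , (λ g≗k (e , (N , limit) , Φe) →
                      e , (N , λ n N≤n → trans (cong (guess Ψ) (sym (↾-cong n (λ i _ → g≗k i)))) (limit n N≤n))
                        , proj₂ (PartialFunction.resp (Φ e)) g≗k Φe)
    ; functional = λ {g} {h} {h′} (e , limit , Φe) (e′ , limit′ , Φe′) →
        PartialFunction.functional (Φ e) Φe
          (subst (λ e → Graph (Φ e) g h′) (⟶-unique limit′ limit) Φe′)
    }

  -- Interleaving the first b functions Φ e, discarding those caught outside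
  -- the homogeneous class.
  module _ {R : List ℕ → ℕ} (R-computable : Computable R) (b : ℕ) where

    open Homogeneous R-computable

    output : ℕ → ℕ → ℕ → ℕ
    output c e v = approx u c (e ∷ v ∷ [])

    opaque
      refuted : ℕ → ℕ → ℕ
      refuted c e = faults (output c e) c

      refutations : ℕ → ℕ
      refutations c = ∑ b λ e → sgn (refuted c e)

      selected : ℕ → ℕ → ℕ
      selected c v = natrec 0 (λ e y → ifz y (isZero (refuted c e) * output c e v) y) b

    private
      outputʳ : {c e v : Baire → Vec ℕ n → ℕ} → Recursive c → Recursive e → Recursive v →
                Recursive (λ g xs → output (c g xs) (e g xs) (v g xs))
      outputʳ r s t = approxʳ u ⟦ r ◂ s ◂ t ◂ ε ⟧

      opaque
        unfolding refuted refutations selected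

        refutedʳ : {c e : Baire → Vec ℕ n → ℕ} → Recursive c → Recursive e →
                   Recursive (λ g xs → refuted (c g xs) (e g xs))
        refutedʳ r s = faultsʳ (outputʳ (r ⟦ vars₁ ⟧) (s ⟦ vars₁ ⟧) (var 0F)) r

        refutationsʳ : {c : Baire → Vec ℕ n → ℕ} → Recursive c →
                       Recursive (λ g xs → refutations (c g xs))
        refutationsʳ r = ∑ʳ (const b) (sgnʳ (refutedʳ (r ⟦ vars₁ ⟧) (var 0F)))

        selectedʳ : {c v : Baire → Vec ℕ n → ℕ} → Recursive c → Recursive v →
                    Recursive (λ g xs → selected (c g xs) (v g xs))
        selectedʳ r s = natrecʳ (const b) (const 0)
          (ifzʳ (var 1F)
            (isZeroʳ (refutedʳ (r ⟦ vars₂ ⟧) (var 0F)) *ʳ outputʳ (r ⟦ vars₂ ⟧) (var 0F) (s ⟦ vars₂ ⟧))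
            (var 1F))

    opaque
      unfolding refuted

      refuted⁺ : ∀ {c e v y s} → v < c → s < c → output c e v ≡ suc y → bad v y s ≢ 0 →
                 refuted c e ≢ 0
      refuted⁺ {c} {e} = faults⁺ (output c e)

      refuted⁻ : ∀ {c e} → refuted c e ≢ 0 →
                 ∃[ v ] ∃[ s ] ∃[ y ] v < c × s < c × output c e v ≡ suc y × bad v y s ≢ 0
      refuted⁻ {c} {e} = faults⁻ (output c e)

    opaque
      unfolding refutations

      refutations-≤ : ∀ {c d} → (∀ e → refuted c e ≢ 0 → refuted d e ≢ 0) →
                      refutations c ≤ refutations d
      refutations-≤ c⊆d = ∑-mono b (λ e → sgn-mono (c⊆d e))

      -- For nested sets, equal size means equality. This lets the count stand in for the set of
      -- refuted functions.
      refutations-≡ : ∀ {c d e} → (∀ e → refuted c e ≢ 0 → refuted d e ≢ 0) →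
                      refutations c ≡ refutations d → e < b → refuted c e ≡ 0 → refuted d e ≡ 0
      refutations-≡ {c} {d} c⊆d eq e<b = sgn≡sgn
        (∑-≡ b {λ e → sgn (refuted c e)} {λ e → sgn (refuted d e)} (λ e → sgn-mono (c⊆d e)) eq e<b)

    opaque
      unfolding selected

      selected-sound : ∀ {c v y} → selected c v ≡ suc y →
                       ∃[ e ] e < b × refuted c e ≡ 0 × output c e v ≡ suc y
      selected-sound {c} {v} {y} = go b
        where
        go : ∀ b → natrec 0 (λ e y → ifz y (isZero (refuted c e) * output c e v) y) b ≡ suc y →
             ∃[ e ] e < b × refuted c e ≡ 0 × output c e v ≡ suc y
        go (suc b) eq with natrec 0 (λ e y → ifz y (isZero (refuted c e) * output c e v) y) b in previous
        ... | suc _ = let e , e<b , p = go b (trans previous eq) in e , m<n⇒m<1+n e<b , p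
        ... | zero with refuted c b in fine
        ...   | zero = b , ≤-refl , fine , trans (sym (*-identityˡ _)) eq

      selected-complete : ∀ {c e v} → e < b → refuted c e ≡ 0 → output c e v ≢ 0 → selected c v ≢ 0
      selected-complete {c} {e} {v} = go b
        where
        go : ∀ b → e < b → refuted c e ≡ 0 → output c e v ≢ 0 →
             natrec 0 (λ e y → ifz y (isZero (refuted c e) * output c e v) y) b ≢ 0
        go (suc b) e<1+b fine out eq
          with natrec 0 (λ e y → ifz y (isZero (refuted c e) * output c e v) y) b in previous
        ... | zero with m≤n⇒m<n∨m≡n (s≤s⁻¹ e<1+b)
        ...   | inj₁ e<b  = go b e<b fine out previous
        ...   | inj₂ refl = ≢0* {isZero (refuted c e)} (λ z → isZero≡0 z fine) out eq

    private
      -- `suc r ∸ j` is nonzero exactly if `j ≤ r`, and `isZero` produces the zero at which `mu`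
      -- stops.
      ready : ∀ j → Recursive (λ g (xs : Vec ℕ 2) →
                isZero ((suc (refutations (code (g ↾ lookup xs 0F))) ∸ j)
                        * selected (code (g ↾ lookup xs 0F)) (lookup xs 1F)))
      ready j = isZeroʳ ((sucʳ (refutationsʳ c) ∸ʳ const j) *ʳ selectedʳ c (var 1F))
        where c = restrictionʳ (var 0F)

      pick : Recursive (λ g (xs : Vec ℕ 2) →
               pred (selected (code (g ↾ lookup xs 0F)) (lookup xs 1F)))
      pick = predʳ (selectedʳ (restrictionʳ (var 0F)) (var 1F))

      double-plus : Recursive (λ _ (xs : Vec ℕ 2) → lookup xs 0F + 2 * lookup xs 1F)
      double-plus = var 0F +ʳ const 2 *ʳ var 1F

    -- Waits until j of the functions are refuted before trusting the others.
    element : ℕ → Program 1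
    element j = comp (pick .program) (mu (ready j .program) ∷ proj 0F ∷ [])

    branchOf : ℕ → Program 1
    branchOf j = comp (element j) (rec (const {0} 1 .program) step ∷ [])
      where
      step : Program 2
      step = comp (double-plus .program) (comp (element j) (proj 1F ∷ []) ∷ proj 1F ∷ [])

    branchOf-computes : ∀ {g j x} → (∀ v → g ⊢ element j [ v ∷ [] ]⇓ x v) →
                        ∀ n → g ⊢ branchOf j [ n ∷ [] ]⇓ branch x n
    branchOf-computes {g} {j} {x} d n = comp (node n ∷ []) (d (branchNode x n))
      where
      node : ∀ n → g ⊢ rec (const {0} 1 .program) _ [ n ∷ [] ]⇓ branchNode x n
      node zero    = rec0 (const 1 .computes g [])
      node (suc n) = recS (node n)
        (comp (comp (proj ∷ []) (d _) ∷ proj ∷ []) (double-plus .computes g (x _ ∷ branchNode x n ∷ [])))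

    opaque
      unfolding refutations

      refutations≤ : ∀ c → refutations c ≤ b
      refutations≤ c = ∑≤ b (λ e → sgn≤1 (refuted c e))

    learner : Learner
    learner = record
      { guess      = λ σ → index (branchOf (refutations (code σ)))
      ; computable = recursive .program , λ g σ → recursive .computes g (code σ ∷ [])
      }
      where
      recursive : Recursive (λ _ (xs : Vec ℕ 1) → index (branchOf (refutations (lookup xs 0F))))
      recursive = recursive-≗
        (λ _ xs → table≡ (index ∘ branchOf) (refutations≤ (lookup xs 0F)))
        (tableʳ (index ∘ branchOf) b (refutationsʳ (var 0F)))

    -- The learner on a fixed oracle

    module _ (g : Baire) where

      private
        c : ℕ → ℕ
        c n = code (g ↾ n)

      output-mono : ∀ {m n e v y} → m ≤ n → output (c m) e v ≡ suc y → output (c n) e v ≡ suc y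
      output-mono m≤n = approx-mono (code-⊑ g m≤n) u

      refuted-mono : ∀ {m n} e → m ≤ n → refuted (c m) e ≢ 0 → refuted (c n) e ≢ 0
      refuted-mono {m} {n} e m≤n p =
        let v , s , y , v<c , s<c , eq , q = refuted⁻ p
        in refuted⁺ (<-≤-trans v<c (code-mono g m≤n)) (<-≤-trans s<c (code-mono g m≤n))
             (output-mono m≤n eq) q

      refutations-mono : ∀ {m n} → m ≤ n → refutations (c m) ≤ refutations (c n)
      refutations-mono m≤n = refutations-≤ (λ e → refuted-mono e m≤n)

      -- The guess can change only together with the count, which is monotone and at most `b`. This
      -- holds for every oracle `g`.
      mindChanges-bounded : AtMost b (mindChanges learner g)
      mindChanges-bounded = AtMost-⊆ (λ change eq → change (cong (index ∘ branchOf) eq))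
        (increases-bounded refutations-mono (λ n → refutations≤ (c n)))

      module _ {j} (limit : (λ n → refutations (c n)) ⟶ j) where

        private
          N = proj₁ limit

        -- Once the count at stage `m` has reached its limit `j`, it equals the count at every later
        -- stage, so the refuted set is final. Convergence may formally be witnessed only at a later
        -- `N`, whence the comparison with a stage `L` beyond both.
        unrefuted-forever : ∀ {m n e} → e < b → j ≤ refutations (c m) → refuted (c m) e ≡ 0 →
                            refuted (c n) e ≡ 0
        unrefuted-forever {m} {n} {e} e<b j≤ fine with refuted (c n) e ≟ 0
        ... | yes eq = eq
        ... | no neq = contradiction settled (refuted-mono e (≤-trans (m≤n⊔m m n) (m≤n⊔m N (m ⊔ n))) neq)
          where
          L = N ⊔ (m ⊔ n)
          m≤L : m ≤ L
          m≤L = ≤-trans (m≤m⊔n m n) (m≤n⊔m N (m ⊔ n))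
          same : refutations (c m) ≡ refutations (c L)
          same = ≤-antisym (refutations-mono m≤L)
            (≤-trans (≤-reflexive (proj₂ limit L (m≤m⊔n N (m ⊔ n)))) j≤)
          settled : refuted (c L) e ≡ 0
          settled = refutations-≡ (λ e → refuted-mono e m≤L) same e<b fine

        unrefuted⇒Good : ∀ {m e v y} → e < b → j ≤ refutations (c m) → refuted (c m) e ≡ 0 →
                         output (c m) e v ≡ suc y → Good v y
        unrefuted⇒Good {m} {e} {v} {y} e<b j≤ fine eq s with bad v y s ≟ 0
        ... | yes good = good
        ... | no wrong = contradiction (unrefuted-forever {m} {L} e<b j≤ fine)
              (refuted⁺
                (≤-trans (s≤s (≤-trans (m≤m⊔n v s) (m≤n⊔m m (v ⊔ s)))) (n≤code g L))
                (≤-trans (s≤s (≤-trans (m≤n⊔m v s) (m≤n⊔m m (v ⊔ s)))) (n≤code g L))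
                (output-mono (m≤n⇒m≤1+n (m≤m⊔n m (v ⊔ s))) eq) wrong)
          where L = suc (m ⊔ (v ⊔ s))

        module _ {e₀ h} (e₀<b : e₀ < b) (Φe₀ : Graph (Φ e₀) g h) (h∈ : Class h) where

          never-refuted : ∀ n → refuted (c n) e₀ ≡ 0
          never-refuted n with refuted (c n) e₀ ≟ 0
          ... | yes eq = eq
          ... | no neq =
            let v , s , y , _ , _ , eq , wrong = refuted⁻ neq
                y≡hv = deterministic (approx-sound {g} {n} u eq) (Φ⇒u Φe₀ v)
            in contradiction (subst (λ y → bad v y s ≡ 0) (sym y≡hv) (h∈ v s)) wrong

          -- The total function `Φ e₀` is never refuted and so guarantees that the search ends. The
          -- value found may come from another `e`, possibly partial; it is good because the count
          -- was final when it was accepted.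
          element-good : ∀ v → ∃[ y ] Good v y × g ⊢ element j [ v ∷ [] ]⇓ y
          element-good v =
            pred y₀ , unrefuted⇒Good {k} e<b j≤ fine (trans eq (cong suc (sym (cong pred y≡)))) ,
            comp (mu-least (ready j) g (v ∷ []) {k} found below ∷ proj ∷ []) (pick .computes g (k ∷ v ∷ []))
            where
            out = approx-complete g (Φ⇒u Φe₀ v)
            -- By this stage the count has settled and `Φ e₀` has produced its value at `v`.
            L = N ⊔ proj₁ out
            test : ℕ → ℕ
            test n = isZero ((suc (refutations (c n)) ∸ j) * selected (c n) v)
            selected≢0 : selected (c L) v ≢ 0
            selected≢0 = selected-complete e₀<b (never-refuted L) λ eq →
              1+n≢0 (trans (sym (output-mono (m≤n⊔m N (proj₁ out)) (proj₂ out))) eq)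
            j<1+ : suc (refutations (c L)) ∸ j ≢ 0
            j<1+ = m<n⇒n≢0 (m<n⇒0<n∸m (s≤s (≤-reflexive (sym (proj₂ limit L (m≤m⊔n N (proj₁ out)))))))
            stage = least test {L} (≢0⇒isZero≡0 (≢0* j<1+ selected≢0))
            k = proj₁ stage
            found = proj₁ (proj₂ (proj₂ stage))
            below = proj₂ (proj₂ (proj₂ stage))
            both = *≢0 {suc (refutations (c k)) ∸ j} (isZero≡0 found)
            y₀ = selected (c k) v
            y≡ = proj₂ (≢0⇒suc (proj₂ both))
            j≤ : j ≤ refutations (c k)
            j≤ = s≤s⁻¹ (≰⇒> λ r<j → proj₁ both (m≤n⇒m∸n≡0 r<j))
            choice = selected-sound y≡
            e<b = proj₁ (proj₂ choice)
            fine = proj₁ (proj₂ (proj₂ choice))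
            eq = proj₂ (proj₂ (proj₂ choice))

          opaque
            learned-branch : ∃[ x ] Class x × Graph (learned learner) g (branch x)
            learned-branch = x , (λ v → proj₁ (proj₂ (element-good v)))
              , index (branchOf j) , (N , λ n N≤n → cong (index ∘ branchOf) (proj₂ limit n N≤n))
              , Φ-index (branchOf-computes {g} {j} {x} (λ v → proj₂ (proj₂ (element-good v))))
              where
              x : Baire
              x v = proj₁ (element-good v)

    opaque
      learned-branches : ExcludedMiddle 0ℓ → ∀ {P : Pred Baire 0ℓ} {Γ} →
        (∀ g h → Graph Γ g h → ∃[ e ] e < b × Graph (Φ e) g h) →
        (∀ {g} → P g → dom Γ g) → (∀ g h → P g → Graph Γ g h → Class h) →
        ∀ {g} → P g → ∃[ x ] Class x × Graph (learned learner) g (branch x)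
      learned-branches em nonuniform P⊆dom into {g} g∈P =
        let h , graph  = P⊆dom g∈P
            _ , e<b , Φe = nonuniform g h graph
            _ , limit  = bounded-monotone-converges em (refutations-mono g) (λ n → refutations≤ (code (g ↾ n)))
        in learned-branch g limit e<b Φe (into g h g∈P graph)

  -- Transfer of completeness

  boundedlyNonuniform⇒boundedMindChanges : ExcludedMiddle 0ℓ → ∀ {P} →
    Complete (BoundedlyNonuniform Φ) P → Complete (BoundedMindChanges Φ) P
  boundedlyNonuniform⇒boundedMindChanges em {P} complete Q Q-class with NonemptyΠ⁰₁Class.isΠ⁰₁ Q-class
  ... | R , R-computable , Q⇔ with complete (Homogeneous.Class R-computable) (Homogeneous.class R-computable em)
  ...   | Γ , (b , nonuniform) , P⊆dom , into =
    learned Ψ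
    , (Ψ , (λ _ _ graph → graph) , b , λ g _ → mindChanges-bounded R-computable b g)
    , (λ g∈P → let x , _ , graph = values g∈P in branch x , graph)
    , into-Q
    where
    open NonemptyΠ⁰₁Class Q-class
    open Homogeneous R-computable
    Ψ : Learner
    Ψ = learner R-computable b
    values : ∀ {g} → P g → ∃[ x ] Class x × Graph (learned Ψ) g (branch x)
    values = learned-branches R-computable b em {P} {Γ} nonuniform P⊆dom into
    into-Q : ∀ g h → P g → Graph (learned Ψ) g h → Q h
    into-Q g h g∈P graph = Equivalence.from (Q⇔ h) λ n →
      -- `h` agrees with `branch x` only pointwise. Membership in `Q` is transferred through `R`,
      -- which sees finite prefixes only.
      trans (cong R (↾-cong n λ i _ → functional (learned Ψ) {g} {h} {branch x} graph branch-graph i))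
        (Equivalence.to (Q⇔ (branch x)) (branch-sound {Q} Q⇔ binary nonempty {x} x∈) n)
      where
      open PartialFunction using (functional)
      x = proj₁ (values g∈P)
      x∈ = proj₁ (proj₂ (values g∈P))
      branch-graph = proj₂ (proj₂ (values g∈P))

Complete-⊆ : ∀ {C D : PartialFunction → Set} {P} → (∀ {Γ} → C Γ → D Γ) → Complete C P → Complete D P
Complete-⊆ C⊆D complete Q Q-class =
  let Γ , CΓ , rest = complete Q Q-class in Γ , C⊆D CΓ , rest

corollary20 : ExcludedMiddle 0ℓ →
    (Φ : ℕ → PartialFunction) → EffectiveEnumeration Φ →
    (P : Pred Baire 0ℓ) → NonemptyΠ⁰₁Class P →
    (Complete (BoundedMindChanges Φ) P ⇔ Complete (BoundedGuesses Φ) P) ×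
    (Complete (BoundedGuesses Φ) P ⇔ Complete (BoundedlyNonuniform Φ) P)
corollary20 em Φ enumeration P _ =
    mk⇔ weaken (back ∘ weaken′) , mk⇔ weaken′ (weaken ∘ back)
  where
  weaken : Complete (BoundedMindChanges Φ) P → Complete (BoundedGuesses Φ) P
  weaken = Complete-⊆ {C = BoundedMindChanges Φ} {BoundedGuesses Φ} {P}
    (λ {Γ} → boundedMindChanges⇒boundedGuesses enumeration {Γ})
  weaken′ : Complete (BoundedGuesses Φ) P → Complete (BoundedlyNonuniform Φ) P
  weaken′ = Complete-⊆ {C = BoundedGuesses Φ} {BoundedlyNonuniform Φ} {P}
    (λ {Γ} → boundedGuesses⇒boundedlyNonuniform enumeration {Γ})
  back : Complete (BoundedlyNonuniform Φ) P → Complete (BoundedMindChanges Φ) P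
  back = boundedlyNonuniform⇒boundedMindChanges enumeration em {P}
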